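{- Let $\mathcal{U}$ be a strategic $(p^+)$-filter on $E$. Then every analytic set $\mathbb{A}\subseteq 2^\omega\times E^{[\infty]}$ is perfectly $\mathcal{U}$-strategically Ramsey.
   Context: $F$ is a countable field and $E$ a countably infinite-dimensional $F$-vector space with fixed basis $(e_n)$; $\mathrm{supp}(v)$ is the set of indices of nonzero coefficients of $v\ne0$. Block sequences: sequences of nonzero vectors with $\max\mathrm{supp}(x_n)<\min\mathrm{supp}(x_{n+1})$; $E^{[\infty]}$ (Polish, subspace of $E^\omega$) and $E^{[<\infty]}$ are the infinite and finite ones. $Y\preceq X$ iff $\langle Y\rangle\subseteq\langle X\rangle$; $Y\preceq^*X$ iff some tail of $Y$ is $\preceq X$. Family: nonempty subset of $E^{[\infty]}$ upward closed under $\preceq^*$; filter: family whose any two members have a common $\preceq$-lower bound in it; $\mathcal{H}\restriction X=\{Y\in\mathcal{H}:Y\preceq X\}$. Full: whenever $D\subseteq E$ and $X\in\mathcal{H}$ are such that every $Y\in\mathcal{H}\restriction X$ has some $Z\preceq Y$ with $\langle Z\rangle\subseteq D$, there is $Z\in\mathcal{H}\restriction X$ with $\langle Z\rangle\subseteq D$. $(p)$: every $\preceq$-decreasing sequence in $\mathcal{H}$ has a member of $\mathcal{H}$ that is $\preceq^*$ each term; $(p^+)$-filter: full filter with $(p)$. Strategic: whenever $X\in\mathcal{H}$ and $\alpha$ is a strategy for II in $G[X]$, some outcome of $\alpha$ lies in $\mathcal{H}$. Games for $\vec x\in E^{[<\infty]}$, $X\in E^{[\infty]}$: in $F[\vec x,X]$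 I plays $n_k\in\omega$, II plays nonzero $y_k\in\langle X\rangle$ with $n_k<\min\mathrm{supp}(y_k)$; in $G[\vec x,X]$ I plays $Y_k\in E^{[\infty]}$, $Y_k\preceq X$, II plays nonzero $y_k\in\langle Y_k\rangle$; II's moves are supported above $\vec x$ and form a block sequence; outcome $\vec x^\frown(y_k)$; $G[X]=G[\emptyset,X]$. $[\sigma]$ is the set of outcomes of plays where I follows $\sigma$. $\mathbb{S}$: nonempty perfect subtrees of $2^{<\omega}$ ordered by inclusion; $[p]$ the branches of $p$. $\mathbb{A}$ is perfectly $\mathcal{U}$-strategically Ramsey if for every $\vec x\in E^{[<\infty]}$, $X\in\mathcal{U}$ and $p\in\mathbb{S}$ there are $Y\in\mathcal{U}\restriction X$ and $q\le p$ such that either (i) I has a strategy $\sigma$ in $F[\vec x,Y]$ with $([q]\times[\sigma])\cap\mathbb{A}=\emptyset$, or (ii) for every $f\in[q]$, II has a strategy in $G[\vec x,Y]$ all of whose outcomes lie in $\mathbb{A}_f=\{Z:(f,Z)\in\mathbb{A}\}$. -}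

module Defs where

open import Level using (0ℓ)
open import Algebra.Bundles using (CommutativeRing)
open import Algebra.Module.Bundles using (Module)
import Algebra.Definitions as AlgDefs
import Algebra.Definitions.RawMonoid as RawMonoidDefs
open import Data.Bool.Base using (Bool; true; false)
open import Data.Fin.Base using (toℕ)
open import Data.List.Base using (List; []; _∷_; _++_; _∷ʳ_; applyUpTo)
open import Data.List.Relation.Unary.All as All using (All)
open import Data.List.Relation.Unary.Linked as Linked using (Linked)
open import Data.Nat.Base using (ℕ; zero; suc; _+_; _<_)
open import Data.Product.Base using (Σ; Σ-syntax; ∃-syntax; _×_; _,_; proj₁; proj₂)
open import Data.Sum.Base using (_⊎_)
open import Data.Vec.Functional using (Vector)
open import Function.Bundles using (_⇔_)
open import Function.Definitions using (Surjective)
open import Relation.Binary.Definitions using (_Respects_)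
open import Relation.Binary.PropositionalEquality.Core using (_≡_)
open import Relation.Nullary.Negation.Core using (¬_)
open import Relation.Unary using (Pred; _∈_; _∉_; _⊆_)

IsField : CommutativeRing 0ℓ 0ℓ → Set
IsField F = 1# ≉ 0# × (∀ x → x ≉ 0# → Invertible 1# _*_ x)
  where
  open CommutativeRing F
  open AlgDefs _≈_ using (Invertible)

-- A field is nonempty, so "countable" (possibly finite) means being the image of ℕ.
IsCountable : CommutativeRing 0ℓ 0ℓ → Set
IsCountable F = ∃[ enum ] Surjective {A = ℕ} _≡_ _≈_ enum
  where open CommutativeRing F

Cantor : Set
Cantor = ℕ → Bool

------------------------------------------------------------------------
-- Perfect trees.  A node of 2^{<ω} is listed from the root, so that the
-- initial segment f ↾ n is applyUpTo f n.

record IsPerfectTree (p : Pred (List Bool) 0ℓ) : Set where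
  field
    nonempty : ∃[ s ] s ∈ p
    closed   : ∀ s t → (s ++ t) ∈ p → s ∈ p
    splits   : ∀ s → s ∈ p →
               ∃[ t ] ((s ++ t) ∷ʳ false) ∈ p × ((s ++ t) ∷ʳ true) ∈ p

PerfectTree : Set₁
PerfectTree = Σ (Pred (List Bool) 0ℓ) IsPerfectTree

_≤ᵀ_ : PerfectTree → PerfectTree → Set
q ≤ᵀ p = proj₁ q ⊆ proj₁ p

[_]ᵀ : PerfectTree → Pred Cantor 0ℓ
[ p ]ᵀ f = ∀ n → applyUpTo f n ∈ proj₁ p

------------------------------------------------------------------------

module Span {F : CommutativeRing 0ℓ 0ℓ} (E : Module F 0ℓ 0ℓ) where

  open CommutativeRing F using (_≈_; _≉_; 0#) renaming (Carrier to Scalar)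
  open Module E
  open RawMonoidDefs +ᴹ-rawMonoid using (sum)

  lin : (ℕ → Carrierᴹ) → ∀ {n} → Vector Scalar n → Carrierᴹ
  lin x c = sum (λ i → c i *ₗ x (toℕ i))

  ⟨_⟩ : (ℕ → Carrierᴹ) → Pred Carrierᴹ 0ℓ
  ⟨ x ⟩ v = ∃[ n ] Σ[ c ∈ Vector Scalar n ] v ≈ᴹ lin x c

  record IsBasis (e : ℕ → Carrierᴹ) : Set where
    field
      spans       : ∀ v → v ∈ ⟨ e ⟩
      independent : ∀ {n} (c : Vector Scalar n) → lin e c ≈ᴹ 0ᴹ → ∀ i → c i ≈ 0#

open Span public using (IsBasis)

------------------------------------------------------------------------
-- Block sequences in a space E with basis e.  Vectors are taken up to
-- ≈ᴹ and sequences up to termwise ≈ᴹ.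

module Blocks {F : CommutativeRing 0ℓ 0ℓ} (E : Module F 0ℓ 0ℓ)
              (e : ℕ → Module.Carrierᴹ E) where

  open CommutativeRing F using (_≈_; _≉_; 0#) renaming (Carrier to Scalar)
  open Module E
  open Span E hiding (IsBasis)

  -- When e is a basis the expansion c of v is unique up to trailing
  -- zeros, so the choice of c is immaterial.
  _∈supp_ : ℕ → Carrierᴹ → Set
  k ∈supp v = ∃[ n ] Σ[ c ∈ Vector Scalar n ]
              v ≈ᴹ lin e c × ∃[ i ] toℕ i ≡ k × c i ≉ 0#

  -- n < min supp v
  _<supp_ : ℕ → Carrierᴹ → Set
  n <supp v = ∀ {j} → j ∈supp v → n < j

  -- max supp v < min supp w
  _≪_ : Carrierᴹ → Carrierᴹ → Set
  v ≪ w = ∀ {i} → i ∈supp v → i <supp w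

  IsBlock : (ℕ → Carrierᴹ) → Set
  IsBlock x = (∀ n → ¬ x n ≈ᴹ 0ᴹ) × (∀ n → x n ≪ x (suc n))

  -- E^[∞]
  BlockSeq : Set
  BlockSeq = Σ (ℕ → Carrierᴹ) IsBlock

  -- E^[<∞]
  FinBlockSeq : Set
  FinBlockSeq = Σ[ x ∈ List Carrierᴹ ] All (λ v → ¬ v ≈ᴹ 0ᴹ) x × Linked _≪_ x

  infix 4 _≼_ _≼*_

  _≼_ : BlockSeq → BlockSeq → Set
  Y ≼ X = ⟨ proj₁ Y ⟩ ⊆ ⟨ proj₁ X ⟩

  _≼*_ : BlockSeq → BlockSeq → Set
  Y ≼* X = ∃[ m ] ⟨ (λ n → proj₁ Y (m + n)) ⟩ ⊆ ⟨ proj₁ X ⟩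

  _⌢_ : List Carrierᴹ → (ℕ → Carrierᴹ) → ℕ → Carrierᴹ
  ([]       ⌢ y) n       = y n
  ((x ∷ _)  ⌢ y) zero    = x
  ((_ ∷ xs) ⌢ y) (suc n) = (xs ⌢ y) n

  ----------------------------------------------------------------------
  -- The game F[x⃗,X].  A strategy for I sends II's past moves
  -- y₀,…,y_{k-1} to n_k.

  StrategyI : Set
  StrategyI = List Carrierᴹ → ℕ

  -- Z is the outcome of a play of F[x⃗,X] in which I follows σ.  That II's
  -- moves are nonzero, lie above x⃗ and form a block sequence is
  -- equivalent to x⃗ ⌢ y being a block sequence, as Z is.
  OutcomeF : FinBlockSeq → BlockSeq → StrategyI → Pred BlockSeq 0ℓ
  OutcomeF (x , _) (X , _) σ (Z , _) =
    Σ[ y ∈ (ℕ → Carrierᴹ) ]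
      (∀ k → y k ∈ ⟨ X ⟩ × σ (applyUpTo y k) <supp y k) ×
      (∀ n → Z n ≈ᴹ (x ⌢ y) n)

  ----------------------------------------------------------------------
  -- The game G[x⃗,X].  A strategy for II sends I's moves Y₀,…,Y_k to y_k
  -- (its value at [] is irrelevant).
  -- move need not respect termwise ≈ᴹ of I's moves: precomposing with a
  -- choice of representatives makes it do so without adding outcomes.

  reply : (List BlockSeq → Carrierᴹ) → (ℕ → BlockSeq) → ℕ → Carrierᴹ
  reply α Y k = α (applyUpTo Y (suc k))

  -- Legality is imposed along infinite plays; every finite sequence of
  -- legal moves of I extends to one.
  record StrategyII (x : FinBlockSeq) (X : BlockSeq) : Set where
    field
      move  : List BlockSeq → Carrierᴹ
      legal : ∀ Y → (∀ k → Y k ≼ X) →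
              (∀ k → reply move Y k ∈ ⟨ proj₁ (Y k) ⟩) ×
              IsBlock (proj₁ x ⌢ reply move Y)

    outcome : ∀ Y → (∀ k → Y k ≼ X) → BlockSeq
    outcome Y Y≼X = (proj₁ x ⌢ reply move Y) , proj₂ (legal Y Y≼X)

  open StrategyII public using (outcome)

  ∅ : FinBlockSeq
  ∅ = [] , All.[] , Linked.[]

  ----------------------------------------------------------------------
  -- Families.  Upward closure makes them invariant under termwise ≈ᴹ.

  record IsFamily (H : Pred BlockSeq 0ℓ) : Set where
    field
      nonempty : ∃[ X ] X ∈ H
      upward   : ∀ {X Y} → X ∈ H → X ≼* Y → Y ∈ H

  IsFilter : Pred BlockSeq 0ℓ → Set
  IsFilter H = IsFamily H ×
    (∀ {X Y} → X ∈ H → Y ∈ H → ∃[ Z ] Z ∈ H × Z ≼ X × Z ≼ Y)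

  _↾_ : Pred BlockSeq 0ℓ → BlockSeq → Pred BlockSeq 0ℓ
  (H ↾ X) Y = Y ∈ H × Y ≼ X

  IsFull : Pred BlockSeq 0ℓ → Set₁
  IsFull H = ∀ (D : Pred Carrierᴹ 0ℓ) → D Respects _≈ᴹ_ → ∀ X → X ∈ H →
    (∀ Y → Y ∈ (H ↾ X) → ∃[ Z ] Z ≼ Y × ⟨ proj₁ Z ⟩ ⊆ D) →
    ∃[ Z ] Z ∈ (H ↾ X) × ⟨ proj₁ Z ⟩ ⊆ D

  HasP : Pred BlockSeq 0ℓ → Set
  HasP H = ∀ (X : ℕ → BlockSeq) → (∀ n → X n ∈ H) → (∀ n → X (suc n) ≼ X n) →
    ∃[ Y ] Y ∈ H × (∀ n → Y ≼* X n)

  IsP⁺Filter : Pred BlockSeq 0ℓ → Set₁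
  IsP⁺Filter U = IsFilter U × IsFull U × HasP U

  IsStrategic : Pred BlockSeq 0ℓ → Set
  IsStrategic H = ∀ X → X ∈ H → (α : StrategyII ∅ X) →
    ∃[ Y ] Σ[ Y≼X ∈ (∀ k → Y k ≼ X) ] outcome α Y Y≼X ∈ H

  ----------------------------------------------------------------------
  -- Analytic sets: projections of closed subsets of
  -- (2^ω × E^[∞]) × ω^ω, where E^[∞] is a subspace of E^ω, E discrete.

  IsClosed : Pred (Cantor × BlockSeq × (ℕ → ℕ)) 0ℓ → Set
  IsClosed C = ∀ f X g →
    (∀ n → ∃[ f′ ] ∃[ X′ ] ∃[ g′ ] (f′ , X′ , g′) ∈ C ×
      (∀ k → k < n → f k ≡ f′ k × proj₁ X k ≈ᴹ proj₁ X′ k × g k ≡ g′ k)) →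
    (f , X , g) ∈ C

  IsAnalytic : Pred (Cantor × BlockSeq) 0ℓ → Set₁
  IsAnalytic A = Σ[ C ∈ Pred (Cantor × BlockSeq × (ℕ → ℕ)) 0ℓ ]
    IsClosed C × (∀ f X → (f , X) ∈ A ⇔ (∃[ g ] (f , X , g) ∈ C))

  PerfectlyStrategicallyRamsey :
    Pred BlockSeq 0ℓ → Pred (Cantor × BlockSeq) 0ℓ → Set₁
  PerfectlyStrategicallyRamsey U A =
    ∀ (x : FinBlockSeq) (X : BlockSeq) → X ∈ U → (p : PerfectTree) →
    ∃[ Y ] Σ[ q ∈ PerfectTree ] Y ∈ (U ↾ X) × q ≤ᵀ p ×
      ( (Σ[ σ ∈ StrategyI ] ∀ f Z → f ∈ [ q ]ᵀ → Z ∈ OutcomeF x Y σ → (f , Z) ∉ A)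
      ⊎ (∀ f → f ∈ [ q ]ᵀ →
           Σ[ α ∈ StrategyII x Y ] ∀ V V≼Y → (f , outcome α V V≼Y) ∈ A) )

{-# OPTIONS --safe #-}
module Submission where

-- Sacks fusion reduces the theorem to one-step dichotomies.  Say that (w , s)
-- is avoidable on a tree when on it, for some Y ∈ U, player I has one strategy
-- from the position w against all witnesses extending s.  Fusion makes this
-- decided along every branch f, by a finite part of f.  From a position that
-- is not avoidable, player II can reach one that is still not avoidable for a
-- longer s, since otherwise player I would avoid reaching it and then join, at
-- each position, finitely many of the strategies for the longer s.  Iterating,
-- II builds an outcome together with a witness; closedness concludes.
--
-- The step needs, for sets D f of vectors depending on f ∈ [p], a perfect q
-- and Y ∈ U with either ⟨Y⟩ ⊆ D f for all f ∈ [q], or no ⟨Z⟩ ⊆ D f with Z ≼ Y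
-- and f ∈ [q].  This is where U must be strategic: by Ramsey's theorem for
-- closed sets, a strategy for II against moves of I in U has an outcome in U,
-- and such a strategy can build the tree q along with the vectors of Y.

open import Defs
open import Level using (Level; 0ℓ)
open import Algebra.Bundles using (CommutativeMonoid; CommutativeRing)
open import Algebra.Module.Bundles using (Module)
open import Axiom.ExcludedMiddle using (ExcludedMiddle)
open import Data.Bool.Base using (Bool; true; false; not)
open import Data.Bool.Properties renaming (_≟_ to _≟ᴮ_) using ()
open import Data.Empty using (⊥-elim)
open import Data.Fin.Base as Fin using (Fin; toℕ)
open import Data.List.Membership.Propositional renaming (_∈_ to _∈ˡ_) using ()
open import Data.List.Membership.Propositional.Properties using (∈-applyDownFrom⁺)
open import Data.List.Base
  using (List; []; _∷_; _++_; _∷ʳ_; [_]; length; applyUpTo; applyDownFrom; replicate; map; foldl)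
open import Data.List.Properties
  using (++-assoc; ++-identityʳ; length-++; length-replicate; ∷-injective; ∷ʳ-injective;
         length-applyUpTo; length-applyDownFrom; length-map; applyUpTo-∷ʳ; foldl-∷ʳ; ≡-dec)
open import Data.List.Relation.Unary.All as All using (All)
open import Data.List.Relation.Unary.Any using (here; there)
open import Data.List.Relation.Unary.Linked as Linked using (Linked)
open import Data.Nat.Base using (ℕ; zero; suc; _+_; _∸_; _≤_; _<_; _⊔_; z≤n; s≤s)
open import Data.Nat.Properties
open import Data.Product.Base using (Σ-syntax; ∃; ∃-syntax; _×_; _,_; proj₁; proj₂)
open import Data.Sum.Base using (_⊎_; inj₁; inj₂)
open import Data.Unit.Base using (⊤; tt)
open import Function.Bundles using (Equivalence)
open import Function.Base using (_∘_; id)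
open import Relation.Binary.PropositionalEquality
  using (_≡_; _≢_; refl; sym; trans; cong; cong₂; subst; subst₂; module ≡-Reasoning)
open import Relation.Nullary.Decidable.Core using (yes; no)
open import Relation.Nullary.Negation.Core using (¬_; contradiction)
open import Relation.Unary using (Pred; _∈_; _∉_; _⊆_)

-- Alternative (i) demands one strategy for player I against all branches of `q`, whereas (ii)
-- grants player II a separate strategy for each branch. Hence every property has to be settled by a
-- finite part of the branch: over the finitely many nodes of a level, the numbers that I plays can
-- be joined by a maximum. Failure has to be local as well, which is why `decided` turns failure at
-- a node into failure on all perfect subtrees there.
--
-- The decisions are nested, each property referring to the ones before: `WonByI`, then `Reaches`,
-- whose targets are failures of `WonByI`, then the safe moves, defined from both. Locality makes
-- the sets of safe moves closed in the branch, as the dichotomy for vectors requires.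
--
-- All properties of subspaces are put in a form that passes to `≼*`-smaller sequences, and they are
-- indexed by positions, witness segments and nodes. There are countably many of these, `F` being
-- countable, so (p) yields a single `Y` that has each property which some member of `U` has.

private
  variable
    a ℓ : Level
    A : Set a

-- Countability

Enumerable : Set a → Set a
Enumerable A = Σ[ enum ∈ (ℕ → A) ] ∀ x → ∃[ i ] enum i ≡ x

-- Cantor's walk: down an antidiagonal until the first coordinate vanishes, then on to the next
-- antidiagonal.
walk : ℕ × ℕ → ℕ × ℕ
walk (zero  , j) = suc j , zero
walk (suc i , j) = i , suc j

unpair : ℕ → ℕ × ℕ
unpair zero    = zero , zero
unpair (suc n) = walk (unpair n)

unpair-surjective : ∀ ij → ∃[ n ] unpair n ≡ ij
unpair-surjective (i , j) = onDiagonal (i + j) i j refl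
  where
  onDiagonal : ∀ d i j → i + j ≡ d → ∃[ n ] unpair n ≡ (i , j)
  onDiagonal d i (suc j) eq =
    let n , eq′ = onDiagonal d (suc i) j (trans (sym (+-suc i j)) eq)
    in suc n , cong walk eq′
  onDiagonal d zero zero eq = zero , refl
  onDiagonal (suc d) (suc i) zero eq =
    let n , eq′ = onDiagonal d zero i (suc-injective (trans (cong suc (sym (+-identityʳ i))) eq))
    in suc n , cong walk eq′

enum-ℕ : Enumerable ℕ
enum-ℕ = id , λ n → n , refl

enum-× : ∀ {a b} {A : Set a} {B : Set b} → Enumerable A → Enumerable B → Enumerable (A × B)
enum-× (f , f-surj) (g , g-surj) =
  (λ n → f (proj₁ (unpair n)) , g (proj₂ (unpair n))) ,
  λ (x , y) → let i , eq  = f-surj x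
                  j , eq′ = g-surj y
                  n , eqₙ = unpair-surjective (i , j)
              in n , cong₂ _,_ (trans (cong (f ∘ proj₁) eqₙ) eq) (trans (cong (g ∘ proj₂) eqₙ) eq′)

enum-List : Enumerable A → Enumerable (List A)
enum-List {A = A} (f , f-surj) =
  (λ n → decode (proj₁ (unpair n)) (proj₂ (unpair n))) ,
  λ xs → let k , n , eq = decode-surjective xs
             m , eqₘ = unpair-surjective (k , n)
         in m , trans (cong (λ kn → decode (proj₁ kn) (proj₂ kn)) eqₘ) eq
  where
  decode : ℕ → ℕ → List A
  decode zero    n = []
  decode (suc k) n = f (proj₁ (unpair n)) ∷ decode k (proj₂ (unpair n))

  decode-surjective : ∀ xs → ∃[ k ] ∃[ n ] decode k n ≡ xs
  decode-surjective []       = zero , zero , refl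
  decode-surjective (x ∷ xs) =
    let i , eq = f-surj x
        k , j , eq′ = decode-surjective xs
        n , eqₙ = unpair-surjective (i , j)
    in suc k , n , cong₂ _∷_ (trans (cong (f ∘ proj₁) eqₙ) eq)
                             (trans (cong (decode k ∘ proj₂) eqₙ) eq′)

enum-Bool : Enumerable Bool
enum-Bool = (λ { zero → false ; (suc _) → true }) , λ { false → 0 , refl ; true → 1 , refl }

-- Finite binary strings

maxOver : ℕ → (List Bool → ℕ) → ℕ
maxOver zero    g = g []
maxOver (suc n) g = maxOver n (g ∘ (false ∷_)) ⊔ maxOver n (g ∘ (true ∷_))

≤-maxOver : ∀ {n} g t → length t ≡ n → g t ≤ maxOver n g
≤-maxOver g [] refl          = ≤-refl
≤-maxOver g (false ∷ t) refl = m≤n⇒m≤n⊔o _ (≤-maxOver (g ∘ (false ∷_)) t refl)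
≤-maxOver g (true ∷ t) refl  = m≤n⇒m≤o⊔n _ (≤-maxOver (g ∘ (true ∷_)) t refl)

infix 4 _⊑_ _⊏_

_⊑_ : List Bool → List Bool → Set
s ⊑ t = ∃[ r ] s ++ r ≡ t

_⊏_ : List Bool → Cantor → Set
t ⊏ f = applyUpTo f (length t) ≡ t

⊑-refl : ∀ {s} → s ⊑ s
⊑-refl = [] , ++-identityʳ _

⊑-trans : ∀ {s t u} → s ⊑ t → t ⊑ u → s ⊑ u
⊑-trans {s} (r , refl) (r′ , refl) = r ++ r′ , sym (++-assoc s r r′)

⊑-∷ʳ : ∀ s u b → s ⊑ (s ++ u) ∷ʳ b
⊑-∷ʳ s u b = u ∷ʳ b , sym (++-assoc s u [ b ])

⊑-linear : ∀ {s t u} → s ⊑ u → t ⊑ u → length s ≤ length t → s ⊑ t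
⊑-linear {[]} {t} _ _ _ = t , refl
⊑-linear {x ∷ s} {y ∷ t} (r , refl) (r′ , eq) (s≤s le) =
  let y≡x , eq′ = ∷-injective eq
      r″ , eq″ = ⊑-linear {s} {t} (r , refl) (r′ , eq′) le
  in r″ , cong₂ _∷_ (sym y≡x) eq″

⊑-antisym : ∀ {s t} → s ⊑ t → length t ≤ length s → s ≡ t
⊑-antisym {[]} {[]} _ _ = refl
⊑-antisym {x ∷ s} {y ∷ t} (r , eq) (s≤s le) =
  let x≡y , eq′ = ∷-injective eq in cong₂ _∷_ x≡y (⊑-antisym (r , eq′) le)

⊑-applyUpTo : ∀ (f : Cantor) {m n} → m ≤ n → applyUpTo f m ⊑ applyUpTo f n
⊑-applyUpTo f {n = n} z≤n = applyUpTo f n , refl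
⊑-applyUpTo f (s≤s le) = let r , eq = ⊑-applyUpTo (f ∘ suc) le in r , cong (f 0 ∷_) eq

⊑-⊏ : ∀ {t} f n → t ⊑ applyUpTo f n → t ⊏ f
⊑-⊏ {[]} f n _ = refl
⊑-⊏ {x ∷ t} f (suc n) (r , eq) =
  let x≡ , eq′ = ∷-injective eq in cong₂ _∷_ (sym x≡) (⊑-⊏ (f ∘ suc) n (r , eq′))

⊏-⊑ : ∀ {t} f {n} → t ⊏ f → length t ≤ n → t ⊑ applyUpTo f n
⊏-⊑ f eq le = subst (_⊑ _) eq (⊑-applyUpTo f le)

⊏-applyUpTo : ∀ f n → applyUpTo f n ⊏ f
⊏-applyUpTo f n = cong (applyUpTo f) (length-applyUpTo f n)

applyUpTo-≡ : ∀ {f g : Cantor} {n k} → applyUpTo f n ≡ applyUpTo g n → k < n → f k ≡ g k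
applyUpTo-≡ {n = suc n} {zero}  eq _        = proj₁ (∷-injective eq)
applyUpTo-≡ {n = suc n} {suc k} eq (s≤s lt) = applyUpTo-≡ (proj₂ (∷-injective eq)) lt

applyUpTo-≤ : ∀ {f g : Cantor} {n k} → applyUpTo f n ≡ applyUpTo g n → k ≤ n →
              applyUpTo f k ≡ applyUpTo g k
applyUpTo-≤ {k = zero} eq _ = refl
applyUpTo-≤ {n = suc n} {suc k} eq (s≤s le) =
  cong₂ _∷_ (proj₁ (∷-injective eq)) (applyUpTo-≤ (proj₂ (∷-injective eq)) le)

-- Indices of the nodes of a scheme grow at the front, so the suffix of length `k` is the index of
-- the ancestor at level `k`.
suffix : ∀ k (s : List Bool) → k ≤ length s → ∃[ r ] ∃[ s′ ] s ≡ r ++ s′ × length s′ ≡ k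
suffix k s le with k ≟ length s
... | yes eq = [] , s , refl , sym eq
suffix zero [] le | no k≢ = contradiction refl k≢
suffix k (b ∷ s) le | no k≢ =
  let r , s′ , eq , eq′ = suffix k s (≤-pred (≤∧≢⇒< le k≢)) in b ∷ r , s′ , cong (b ∷_) eq , eq′

⊏-∷ʳ⁻ : ∀ {t b} f → (t ∷ʳ b) ⊏ f → f (length t) ≡ b
⊏-∷ʳ⁻ {t} {b} f eq = proj₂ (∷ʳ-injective _ t (begin
  applyUpTo f (length t) ∷ʳ f (length t)  ≡⟨ applyUpTo-∷ʳ f (length t) ⟩
  applyUpTo f (suc (length t))            ≡⟨ cong (applyUpTo f) (trans (length-++ t) (+-comm _ 1)) ⟨
  applyUpTo f (length (t ∷ʳ b))           ≡⟨ eq ⟩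
  t ∷ʳ b                                  ∎))
  where open ≡-Reasoning

⊏-∷ʳ⁺ : ∀ {t b} f → t ⊏ f → f (length t) ≡ b → (t ∷ʳ b) ⊏ f
⊏-∷ʳ⁺ {t} {b} f eq eq′ = begin
  applyUpTo f (length (t ∷ʳ b))           ≡⟨ cong (applyUpTo f) (trans (length-++ t) (+-comm _ 1)) ⟩
  applyUpTo f (suc (length t))            ≡⟨ applyUpTo-∷ʳ f (length t) ⟨
  applyUpTo f (length t) ∷ʳ f (length t)  ≡⟨ cong₂ _∷ʳ_ eq eq′ ⟩
  t ∷ʳ b                                  ∎
  where open ≡-Reasoning

⊏-⊑⁻ : ∀ {s t} f → s ⊑ t → t ⊏ f → s ⊏ f
⊏-⊑⁻ {t = t} f s⊑t t⊏f = ⊑-⊏ f (length t) (subst (_ ⊑_) (sym t⊏f) s⊑t)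

firstDifference : ∀ (f g : Cantor) n m → applyUpTo f n ≡ applyUpTo g n → applyUpTo f m ≢ applyUpTo g m →
                  ∃[ d ] n ≤ d × applyUpTo f d ≡ applyUpTo g d × f d ≢ g d
firstDifference f g n zero _ differ = contradiction refl differ
firstDifference f g n (suc m) agree differ with ≡-dec _≟ᴮ_ (applyUpTo f m) (applyUpTo g m)
... | no differ′ = firstDifference f g n m agree differ′
... | yes same = m , n≤m , same , λ eq → differ (begin
  applyUpTo f (suc m)     ≡⟨ applyUpTo-∷ʳ f m ⟨
  applyUpTo f m ∷ʳ f m    ≡⟨ cong₂ _∷ʳ_ same eq ⟩
  applyUpTo g m ∷ʳ g m    ≡⟨ applyUpTo-∷ʳ g m ⟩
  applyUpTo g (suc m)     ∎)
  where
  open ≡-Reasoning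
  n≤m : n ≤ m
  n≤m with n ≤? m
  ... | yes n≤m = n≤m
  ... | no n≰m = contradiction (applyUpTo-≤ agree (≰⇒> n≰m)) differ

-- Perfect trees

open IsPerfectTree

Tree : Set₁
Tree = Pred (List Bool) 0ℓ

Branches : Tree → Pred Cantor 0ℓ
Branches p f = ∀ n → applyUpTo f n ∈ p

cut : Tree → List Bool → Tree
cut p t r = r ∈ p × (r ⊑ t ⊎ t ⊑ r)

cut-antitone : ∀ {p s t} → s ⊑ t → cut p t ⊆ cut p s
cut-antitone {s = s} s⊑t (r∈p , inj₂ t⊑r) = r∈p , inj₂ (⊑-trans s⊑t t⊑r)
cut-antitone {s = s} s⊑t {r} (r∈p , inj₁ r⊑t) with ≤-total (length r) (length s)
... | inj₁ le = r∈p , inj₁ (⊑-linear r⊑t s⊑t le)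
... | inj₂ le = r∈p , inj₂ (⊑-linear s⊑t r⊑t le)

cut-mono : ∀ {p q t} → q ⊆ p → cut q t ⊆ cut p t
cut-mono q⊆p (r∈q , cmp) = q⊆p r∈q , cmp

cut-isPerfect : ∀ {p t} → IsPerfectTree p → t ∈ p → IsPerfectTree (cut p t)
cut-isPerfect {p} {t} perfect t∈p = record
  { nonempty = t , t∈p , inj₁ ⊑-refl
  ; closed   = λ s u (su∈p , cmp) → closed perfect s u su∈p , below s u cmp
  ; splits   = split
  }
  where
  below : ∀ s u → (s ++ u ⊑ t ⊎ t ⊑ s ++ u) → s ⊑ t ⊎ t ⊑ s
  below s u (inj₁ su⊑t) = inj₁ (⊑-trans (u , refl) su⊑t)
  below s u (inj₂ t⊑su) with ≤-total (length s) (length t)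
  ... | inj₁ le = inj₁ (⊑-linear (u , refl) t⊑su le)
  ... | inj₂ le = inj₂ (⊑-linear t⊑su (u , refl) le)

  split : ∀ s → s ∈ cut p t →
          ∃[ u ] ((s ++ u) ∷ʳ false) ∈ cut p t × ((s ++ u) ∷ʳ true) ∈ cut p t
  split s (s∈p , inj₂ t⊑s) =
    let u , ∈f , ∈t = splits perfect s s∈p
        above : ∀ b → t ⊑ (s ++ u) ∷ʳ b
        above b = ⊑-trans t⊑s (⊑-∷ʳ s u b)
    in u , (∈f , inj₂ (above false)) , (∈t , inj₂ (above true))
  split s (s∈p , inj₁ (r , refl)) =
    let u , ∈f , ∈t = splits perfect t t∈p
        eq : ∀ b → (t ++ u) ∷ʳ b ≡ (s ++ (r ++ u)) ∷ʳ b
        eq b = cong (_∷ʳ b) (++-assoc s r u)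
        above : ∀ b → t ⊑ (s ++ (r ++ u)) ∷ʳ b
        above b = subst (t ⊑_) (eq b) (⊑-∷ʳ t u b)
    in r ++ u , (subst p (eq false) ∈f , inj₂ (above false))
              , (subst p (eq true) ∈t , inj₂ (above true))

cutᵀ : (p : PerfectTree) (t : List Bool) → t ∈ proj₁ p → PerfectTree
cutᵀ p t t∈p = cut (proj₁ p) t , cut-isPerfect (proj₂ p) t∈p

Branches-cut : ∀ p {t f} → Branches p f → t ⊏ f → Branches (cut p t) f
Branches-cut p {t} {f} f∈p t⊏f n = f∈p n , cmp
  where
  cmp : applyUpTo f n ⊑ t ⊎ t ⊑ applyUpTo f n
  cmp with ≤-total n (length t)
  ... | inj₁ le = inj₁ (subst (applyUpTo f n ⊑_) t⊏f (⊑-applyUpTo f le))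
  ... | inj₂ le = inj₂ (⊏-⊑ f t⊏f le)

Branches-cut-⊏ : ∀ p {t f} → Branches (cut p t) f → t ⊏ f
Branches-cut-⊏ p {t} {f} f∈ with proj₂ (f∈ (length t))
... | inj₁ le = ⊑-antisym le (≤-reflexive (sym (length-applyUpTo f (length t))))
... | inj₂ le = sym (⊑-antisym le (≤-reflexive (length-applyUpTo f (length t))))

-- Nodes of a perfect tree have proper extensions, so `length t` steps lead from any node to one at
-- least as long as `t`; comparability makes that node an extension of `t`.
stem∈ : ∀ {q t} → IsPerfectTree q → (∀ {r} → r ∈ q → r ⊑ t ⊎ t ⊑ r) → t ∈ q
stem∈ {q} {t} perfect comparable = let s , s∈q = nonempty perfect in climb (length t) s s∈q (m≤m+n _ _)
  where
  climb : ∀ n s → s ∈ q → length t ≤ n + length s → t ∈ q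
  climb n s s∈q le with comparable s∈q
  ... | inj₂ (r , refl) = closed perfect t r s∈q
  climb zero s s∈q le | inj₁ s⊑t = subst q (⊑-antisym s⊑t le) s∈q
  climb (suc n) s s∈q le | inj₁ s⊑t =
    let u , ∈f , _ = splits perfect s s∈q
    in climb n ((s ++ u) ∷ʳ false) ∈f
         (≤-trans le (≤-trans (≤-reflexive (sym (+-suc n _)))
           (+-monoʳ-≤ n (subst (suc (length s) ≤_) (sym (longer u))
             (s≤s (≤-trans (m≤m+n _ _) (≤-reflexive (sym (length-++ s)))))))))
    where
    longer : ∀ u → length ((s ++ u) ∷ʳ false) ≡ suc (length (s ++ u))
    longer u = trans (length-++ (s ++ u)) (+-comm _ 1)

-- The index s of a node is read from its last bit, as b ∷ s extends s.
module Scheme (node gap : List Bool → List Bool)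
  (node-∷ : ∀ b s → node (b ∷ s) ≡ (node s ++ gap s) ∷ʳ b) where

  tree : Tree
  tree t = ∃[ s ] t ⊑ node s

  node-⊑ : ∀ r s → node s ⊑ node (r ++ s)
  node-⊑ [] s = ⊑-refl
  node-⊑ (b ∷ r) s =
    ⊑-trans (node-⊑ r s) (subst (node (r ++ s) ⊑_) (sym (node-∷ b (r ++ s))) (⊑-∷ʳ _ _ b))

  -- By induction the parents have the same index, hence the same gap, so the two nodes differ at
  -- most in the last bit. Being comparable and of equal length, they coincide.
  node-injective : ∀ {a b t} → node a ⊑ t → node b ⊑ t → length a ≡ length b → a ≡ b
  node-injective {[]} {[]} _ _ _ = refl
  node-injective {x ∷ a} {y ∷ b} {t} a⊑ b⊑ eq with node-injective {a} {b}
      (⊑-trans (node-⊑ [ x ] a) a⊑) (⊑-trans (node-⊑ [ y ] b) b⊑) (suc-injective eq)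
  ... | refl = cong (_∷ a) (proj₂ (∷ʳ-injective _ _ same))
    where
    x⊑ : (node a ++ gap a) ∷ʳ x ⊑ t
    x⊑ = subst (_⊑ t) (node-∷ x a) a⊑
    y⊑ : (node a ++ gap a) ∷ʳ y ⊑ t
    y⊑ = subst (_⊑ t) (node-∷ y a) b⊑
    len : ∀ z → length ((node a ++ gap a) ∷ʳ z) ≡ length (node a ++ gap a) + 1
    len z = length-++ (node a ++ gap a)
    same : (node a ++ gap a) ∷ʳ x ≡ (node a ++ gap a) ∷ʳ y
    same = ⊑-antisym (⊑-linear x⊑ y⊑ (≤-reflexive (trans (len x) (sym (len y)))))
                     (≤-reflexive (trans (len y) (sym (len x))))

  -- Padding the index with `k` further bits only lengthens the node and guarantees a suffix of
  -- length `k`.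
  through : ∀ k {t} → t ∈ tree → ∃[ r ] ∃[ s ] length s ≡ k × t ⊑ node (r ++ s)
  through k {t} (s , t⊑) =
    let pad = replicate k false
        r , s′ , eq , len = suffix k (pad ++ s)
          (subst (k ≤_) (sym (trans (length-++ pad) (cong (_+ length s) (length-replicate k)))) (m≤m+n k _))
    in r , s′ , len , subst (λ u → t ⊑ node u) eq (⊑-trans t⊑ (node-⊑ pad s))

  node∈ : ∀ s → node s ∈ tree
  node∈ s = s , ⊑-refl

  isPerfect : IsPerfectTree tree
  isPerfect = record
    { nonempty = node [] , node∈ []
    ; closed   = λ s t (u , st⊑) → u , ⊑-trans (t , refl) st⊑
    ; splits   = λ where
        s (u , r , eq) → r ++ gap u ,
          (false ∷ u , [] , trans (++-identityʳ _) (same s r u eq false)) ,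
          (true ∷ u , [] , trans (++-identityʳ _) (same s r u eq true))
    }
    where
    same : ∀ s r u → s ++ r ≡ node u → ∀ b → (s ++ (r ++ gap u)) ∷ʳ b ≡ node (b ∷ u)
    same s r u eq b = begin
      (s ++ (r ++ gap u)) ∷ʳ b  ≡⟨ cong (_∷ʳ b) (++-assoc s r (gap u)) ⟨
      ((s ++ r) ++ gap u) ∷ʳ b  ≡⟨ cong (λ z → (z ++ gap u) ∷ʳ b) eq ⟩
      (node u ++ gap u) ∷ʳ b    ≡⟨ node-∷ b u ⟨
      node (b ∷ u)              ∎
      where open ≡-Reasoning

  width : ℕ → ℕ
  width k = maxOver k (length ∘ node)

  ≤-width : ∀ {k} s → length s ≡ k → length (node s) ≤ width k
  ≤-width s = ≤-maxOver (length ∘ node) s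

  passes : ∀ k {t} → t ∈ tree → width k ≤ length t → ∃[ s ] length s ≡ k × node s ⊑ t
  passes k t∈ le =
    let r , s , len , t⊑ = through k t∈
    in s , len , ⊑-linear (node-⊑ r s) t⊑ (≤-trans (≤-width s len) le)

-- Sacks fusion

module _ {ℓ} {I : Set} (enumI : Enumerable I) (Φ : I → Tree → Set ℓ)
  (Φ-hereditary : ∀ i {p q} → q ⊆ p → Φ i p → Φ i q) (p : PerfectTree)
  (Φ-dense : ∀ i (q : PerfectTree) → q ≤ᵀ p → Σ[ q′ ∈ PerfectTree ] q′ ≤ᵀ q × Φ i (proj₁ q′)) where

  private
    enum : ℕ → I
    enum = proj₁ enumI

    record Stage (k : ℕ) : Set (Level.suc 0ℓ Level.⊔ ℓ) where
      field
        piece      : PerfectTree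
        stem       : List Bool
        piece≤p    : piece ≤ᵀ p
        comparable : ∀ {r} → r ∈ proj₁ piece → r ⊑ stem ⊎ stem ⊑ r
        forced     : Φ (enum k) (proj₁ piece)

      stem∈piece : stem ∈ proj₁ piece
      stem∈piece = stem∈ (proj₂ piece) comparable

      gap : List Bool
      gap = proj₁ (splits (proj₂ piece) stem stem∈piece)

      child∈ : ∀ b → ((stem ++ gap) ∷ʳ b) ∈ proj₁ piece
      child∈ false = proj₁ (proj₂ (splits (proj₂ piece) stem stem∈piece))
      child∈ true  = proj₂ (proj₂ (splits (proj₂ piece) stem stem∈piece))

      half : Bool → PerfectTree
      half b = cutᵀ piece ((stem ++ gap) ∷ʳ b) (child∈ b)

      half≤p : ∀ b → half b ≤ᵀ p
      half≤p b = piece≤p ∘ proj₁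

    open Stage

    next : ∀ {k} → Bool → Stage k → Stage (suc k)
    next {k} b S =
      let q , q≤half , Φq = Φ-dense (enum (suc k)) (half S b) (half≤p S b) in record
        { piece      = q
        ; stem       = (stem S ++ gap S) ∷ʳ b
        ; piece≤p    = half≤p S b ∘ q≤half
        ; comparable = proj₂ ∘ q≤half
        ; forced     = Φq
        }

    stage : ∀ s → Stage (length s)
    stage [] = let q , q≤p , Φq = Φ-dense (enum 0) p id in record
      { piece = q ; stem = [] ; piece≤p = q≤p ; comparable = λ {r} _ → inj₂ (r , refl) ; forced = Φq }
    stage (b ∷ s) = next b (stage s)

    open Scheme (λ s → stem (stage s)) (λ s → gap (stage s)) (λ _ _ → refl)

    stage-≤ : ∀ r s → piece (stage (r ++ s)) ≤ᵀ piece (stage s)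
    stage-≤ []      s = id
    stage-≤ (b ∷ r) s =
      stage-≤ r s ∘ proj₁ ∘ proj₁ (proj₂ (Φ-dense (enum (suc (length (r ++ s))))
        (half (stage (r ++ s)) b) (half≤p (stage (r ++ s)) b)))

    node∈piece : ∀ r s {t} → t ⊑ stem (stage (r ++ s)) → t ∈ proj₁ (piece (stage s))
    node∈piece r s {t} (u , eq) =
      closed (proj₂ (piece (stage s))) t u
        (subst (proj₁ (piece (stage s))) (sym eq) (stage-≤ r s (stem∈piece (stage (r ++ s)))))

    -- A node of the tree above `stem (stage s)` lies below a node whose index ends in some `s′` of
    -- length `k`; `node-injective` forces `s′` to be `s`, and pieces shrink along indices.
    cut-⊆-piece : ∀ k {t} → t ∈ tree → ∀ s → length s ≡ k → stem (stage s) ⊑ t →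
                  cut tree t ⊆ proj₁ (piece (stage s))
    cut-⊆-piece k {t} t∈ s len s⊑t {r} (r∈ , cmp) = either cmp
      where
      above : ∀ {r} → r ∈ tree → stem (stage s) ⊑ r → r ∈ proj₁ (piece (stage s))
      above r∈ s⊑r with through k r∈
      ... | r′ , s′ , len′ , r⊑
        with node-injective {s} {s′} (⊑-trans s⊑r r⊑) (node-⊑ r′ s′) (trans len (sym len′))
      ... | refl = node∈piece r′ s r⊑

      either : r ⊑ t ⊎ t ⊑ r → r ∈ proj₁ (piece (stage s))
      either (inj₁ (u , refl)) = closed (proj₂ (piece (stage s))) r u (above t∈ s⊑t)
      either (inj₂ t⊑r) = above r∈ (⊑-trans s⊑t t⊑r)

  abstract
    -- Every node of length `width k` extends the stem of a stage of level `k`, and `Φ (enum k)` was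
    -- forced on the piece of that stage.
    fusion : Σ[ q ∈ PerfectTree ] q ≤ᵀ p ×
             (∀ i → ∃[ m ] ∀ t → length t ≡ m → t ∈ proj₁ q → Φ i (cut (proj₁ q) t))
    fusion = (tree , isPerfect) ,
      (λ (s , t⊑) → piece≤p (stage s) (node∈piece [] s t⊑)) , force
      where
      force : ∀ i → ∃[ m ] ∀ t → length t ≡ m → t ∈ tree → Φ i (cut tree t)
      force i with proj₂ enumI i
      ... | k , refl = width k , λ t len t∈ → atNode t t∈ (passes k t∈ (≤-reflexive (sym len)))
        where
        atNode : ∀ t → t ∈ tree → ∃[ s ] length s ≡ k × stem (stage s) ⊑ t → Φ (enum k) (cut tree t)
        atNode t t∈ (s , refl , s⊑t) = Φ-hereditary (enum k) (cut-⊆-piece k t∈ s refl s⊑t) (forced (stage s))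

-- Classical principles

module Classical (em : ∀ {ℓ} → ExcludedMiddle ℓ) where

  dne : {P : Set a} → ¬ ¬ P → P
  dne {P = P} ¬¬p with em {P = P}
  ... | yes p = p
  ... | no ¬p = contradiction ¬p ¬¬p

  ¬∀⇒∃¬ : ∀ {b} {P : A → Set b} → ¬ (∀ x → P x) → ∃[ x ] ¬ P x
  ¬∀⇒∃¬ ¬∀ = dne λ ¬∃ → ¬∀ λ x → dne λ ¬p → ¬∃ (x , ¬p)

  abstract
    -- A tree either has a perfect subtree with `H i` or has none, so the disjunction is dense; it
    -- is also hereditary, and fusion applies.
    decided : ∀ {ℓ} {I : Set} → Enumerable I → (H : I → Tree → Set ℓ) →
              (∀ i {p q} → q ⊆ p → H i p → H i q) → (p : PerfectTree) →
              Σ[ q ∈ PerfectTree ] q ≤ᵀ p ×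
              (∀ i → ∃[ m ] ∀ t → length t ≡ m → t ∈ proj₁ q →
                H i (cut (proj₁ q) t) ⊎
                (∀ (r : PerfectTree) → proj₁ r ⊆ cut (proj₁ q) t → ¬ H i (proj₁ r)))
    decided {ℓ} {I} enumI H hereditary p = fusion enumI Φ Φ-hereditary p Φ-dense
      where
      Φ : I → Tree → Set (Level.suc 0ℓ Level.⊔ ℓ)
      Φ i q = H i q ⊎ (∀ (r : PerfectTree) → proj₁ r ⊆ q → ¬ H i (proj₁ r))

      Φ-hereditary : ∀ i {p q} → q ⊆ p → Φ i p → Φ i q
      Φ-hereditary i q⊆p (inj₁ h)     = inj₁ (hereditary i q⊆p h)
      Φ-hereditary i q⊆p (inj₂ never) = inj₂ λ r r⊆q → never r λ x → q⊆p (r⊆q x)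

      Φ-dense : ∀ i (q : PerfectTree) → q ≤ᵀ p → Σ[ q′ ∈ PerfectTree ] q′ ≤ᵀ q × Φ i (proj₁ q′)
      Φ-dense i q q≤p with em {P = Σ[ q′ ∈ PerfectTree ] q′ ≤ᵀ q × H i (proj₁ q′)}
      ... | yes (q′ , q′≤q , h) = q′ , q′≤q , inj₁ h
      ... | no none = q , id , inj₂ λ r r⊆q h → none (r , r⊆q , h)

  module Decided {ℓ} {I : Set} (enumI : Enumerable I) (H : I → Tree → Set ℓ)
    (hereditary : ∀ i {p q} → q ⊆ p → H i p → H i q) (p : PerfectTree) where

    private
      result = decided enumI H hereditary p

    q : PerfectTree
    q = proj₁ result

    q≤p : q ≤ᵀ p
    q≤p = proj₁ (proj₂ result)

    level : I → ℕ
    level i = proj₁ (proj₂ (proj₂ result) i)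

    Eventual : I → Cantor → Set ℓ
    Eventual i f = ∃[ n ] H i (cut (proj₁ q) (applyUpTo f n))

    -- The negative decision at `level i` is impossible: the cut of `r` at the longer of the two
    -- segments of `f` is a perfect subtree on which `H i` holds.
    eventual-refine : ∀ (r : PerfectTree) → r ≤ᵀ q → ∀ i {f} → Branches (proj₁ r) f → ∀ n →
                      H i (cut (proj₁ r) (applyUpTo f n)) →
                      H i (cut (proj₁ q) (applyUpTo f (level i)))
    eventual-refine r r≤q i {f} f∈r n holds
      with proj₂ (proj₂ (proj₂ result) i) (applyUpTo f (level i)) (length-applyUpTo f _) (r≤q (f∈r _))
    ... | inj₁ h     = h
    ... | inj₂ never = contradiction
      (hereditary i (cut-antitone {proj₁ r} (⊑-applyUpTo f (m≤m⊔n n (level i)))) holds)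
      (never (cutᵀ r (applyUpTo f (n ⊔ level i)) (f∈r _))
        (λ x → cut-mono {proj₁ q} r≤q (cut-antitone {proj₁ r} (⊑-applyUpTo f (m≤n⊔m n (level i))) x)))

    eventual-level : ∀ i {f} → Branches (proj₁ q) f → Eventual i f →
                     H i (cut (proj₁ q) (applyUpTo f (level i)))
    eventual-level i f∈q (n , holds) = eventual-refine q id i f∈q n holds

    -- Success would already show at `level i`, so failure depends on that part of the branch alone.
    -- This makes failure an open condition.
    ¬eventual-local : ∀ i {f f′} → Branches (proj₁ q) f′ →
      applyUpTo f′ (level i) ≡ applyUpTo f (level i) → ¬ Eventual i f → ¬ Eventual i f′
    ¬eventual-local i f′∈q same ¬ev ev′ =
      ¬ev (level i , subst (λ t → H i (cut (proj₁ q) t)) same (eventual-level i f′∈q ev′))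

  module _ (fs : ℕ → Cantor) where
    private
      Frequent : List Bool → Set
      Frequent t = ∀ k → ∃[ j ] k ≤ j × t ⊏ fs j

      extend : ∀ t → Frequent t → ∃[ b ] Frequent (t ∷ʳ b)
      extend t freq with em {P = Frequent (t ∷ʳ false)}
      ... | yes freq′ = false , freq′
      ... | no rare = true , λ k →
        let k₁ , none = ¬∀⇒∃¬ rare
            j , le , t⊏ = freq (k ⊔ k₁)
            ≢false : fs j (length t) ≢ false
            ≢false eq = none (j , ≤-trans (m≤n⊔m k k₁) le , ⊏-∷ʳ⁺ (fs j) t⊏ eq)
        in j , ≤-trans (m≤m⊔n k k₁) le , ⊏-∷ʳ⁺ (fs j) t⊏ (isTrue ≢false)
        where
        isTrue : ∀ {b} → b ≢ false → b ≡ true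
        isTrue {false} ≢f = contradiction refl ≢f
        isTrue {true}  _  = refl

      path : ℕ → ∃ Frequent
      path zero    = [] , λ k → k , ≤-refl , refl
      path (suc n) = proj₁ (path n) ∷ʳ proj₁ step , proj₂ step
        where step = extend (proj₁ (path n)) (proj₂ (path n))

      limit : Cantor
      limit n = proj₁ (extend (proj₁ (path n)) (proj₂ (path n)))

      path-limit : ∀ n → applyUpTo limit n ≡ proj₁ (path n)
      path-limit zero    = refl
      path-limit (suc n) = trans (sym (applyUpTo-∷ʳ limit n)) (cong (_∷ʳ limit n) (path-limit n))

    abstract
      -- Compactness of Cantor space, by König's argument: a node that infinitely many terms pass
      -- through has a child with the same property.
      clusterPoint : ∃[ f ] ∀ n k → ∃[ j ] k ≤ j × applyUpTo (fs j) n ≡ applyUpTo f n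
      clusterPoint = limit , λ n k →
        let j , le , eq = proj₂ (path n) k
            len = trans (cong length (sym (path-limit n))) (length-applyUpTo limit n)
        in j , le , trans (trans (cong (applyUpTo (fs j)) (sym len)) eq) (sym (path-limit n))

applyDownFrom-≡ : ∀ {f g : ℕ → A} {n k} → applyDownFrom f n ≡ applyDownFrom g n → k < n → f k ≡ g k
applyDownFrom-≡ {n = suc n} {k} eq (s≤s k≤n) with k ≟ n
... | yes refl = proj₁ (∷-injective eq)
... | no k≢n   = applyDownFrom-≡ (proj₂ (∷-injective eq)) (≤∧≢⇒< k≤n k≢n)

applyDownFrom-cong : ∀ {f g : ℕ → A} n → (∀ k → k < n → f k ≡ g k) → applyDownFrom f n ≡ applyDownFrom g n
applyDownFrom-cong zero    _  = refl
applyDownFrom-cong (suc n) eq = cong₂ _∷_ (eq n ≤-refl) (applyDownFrom-cong n λ k lt → eq k (m≤n⇒m≤1+n lt))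

-- Games on codes of vectors

-- Vectors are coded by natural numbers, and a position of a game is the list
-- of vectors played so far, the latest first; applyDownFrom z k is the
-- position reached after k moves of the play z.

record Space : Set₁ where
  infix 4 _∋_ _≼_ _≼*_
  field
    Sub          : Set
    _∋_          : Sub → ℕ → Set
    Above        : ℕ → ℕ → Set
    Above-mono   : ∀ {m n v} → m ≤ n → Above n v → Above m v
    Legal        : List ℕ → ℕ → Set
    legal-exists : ∀ w Z → ∃[ v ] Z ∋ v × Legal w v
    Span         : Pred ℕ 0ℓ → Pred ℕ 0ℓ
    Span-mono    : ∀ {S T} → S ⊆ T → Span S ⊆ Span T
    Span-closed  : ∀ Z {v} → v ∈ Span (Z ∋_) → Z ∋ v
    tail         : Sub → ℕ → Sub
    tail-∋       : ∀ {Z N v} → tail Z N ∋ v → Z ∋ v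
    tail-Above   : ∀ {Z N v} → tail Z N ∋ v → Above N v

  _≼_ : Sub → Sub → Set
  Z ≼ Y = ∀ {v} → Z ∋ v → Y ∋ v

  -- A tail is expressed by support: beyond a suitable bound, vectors of ⟨Y⟩ are combinations of
  -- late blocks only. In this form the relation needs no mention of blocks.
  _≼*_ : Sub → Sub → Set
  Y ≼* X = ∃[ N ] ∀ {v} → Y ∋ v → Above N v → X ∋ v

  ≼⇒≼* : ∀ {Y X} → Y ≼ X → Y ≼* X
  ≼⇒≼* Y≼X = 0 , λ Y∋v _ → Y≼X Y∋v

  ≼*-≼-trans : ∀ {Y X W} → Y ≼* X → X ≼ W → Y ≼* W
  ≼*-≼-trans (N , Y≼*X) X≼W = N , λ Y∋v above → X≼W (Y≼*X Y∋v above)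

  Hereditary : (Sub → Set ℓ) → Set ℓ
  Hereditary P = ∀ {Y′ Y} → Y′ ≼* Y → P Y → P Y′

  Generates : (ℕ → ℕ) → Sub → Set
  Generates z Z = ∀ {v} → Z ∋ v → ∃[ k ] v ∈ Span (_∈ˡ applyDownFrom z k)

  Meets : Sub → Pred ℕ ℓ → Set ℓ
  Meets Y Q = ∀ Z → Z ≼ Y → ∃[ v ] Z ∋ v × Q v

  -- Any `Z` below `Y′` has a tail below `Y`, and a vector found in the tail lies in `Z`.
  Meets-hereditary : ∀ {Q : Pred ℕ ℓ} → Hereditary (λ Y → Meets Y Q)
  Meets-hereditary (N , Y′≼*Y) meets Z Z≼Y′ =
    let v , ∋v , Qv = meets (tail Z N) λ ∋v → Y′≼*Y (Z≼Y′ (tail-∋ ∋v)) (tail-Above ∋v)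
    in v , tail-∋ ∋v , Qv

  Eventually : Sub → Pred ℕ ℓ → Set ℓ
  Eventually Y Q = ∃[ N ] ∀ {v} → Y ∋ v → Above N v → Q v

  Eventually-hereditary : ∀ {Q : Pred ℕ ℓ} → Hereditary (λ Y → Eventually Y Q)
  Eventually-hereditary (M , Y′≼*Y) (N , ev) = M ⊔ N , λ ∋v above →
    ev (Y′≼*Y ∋v (Above-mono (m≤m⊔n M N) above)) (Above-mono (m≤n⊔m M N) above)

record StrategicFilter (𝕊 : Space) (U : Pred (Space.Sub 𝕊) 0ℓ) : Set₁ where
  open Space 𝕊
  field
    inhabited : ∃ U
    tail∈     : ∀ {Z N} → Z ∈ U → tail Z N ∈ U
    meet      : ∀ {X Y} → X ∈ U → Y ∈ U → ∃[ Z ] Z ∈ U × Z ≼ X × Z ≼ Y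
    full      : ∀ (D : Pred ℕ 0ℓ) X → X ∈ U →
                (∀ Y → Y ∈ U → Y ≼ X → ∃[ Z ] Z ≼ Y × (∀ {v} → Z ∋ v → v ∈ D)) →
                ∃[ Z ] Z ∈ U × (∀ {v} → Z ∋ v → v ∈ D)
    pseudo    : ∀ (X : ℕ → Sub) → (∀ n → X n ∈ U) → (∀ n → X (suc n) ≼ X n) →
                ∃[ Y ] Y ∈ U × (∀ n → Y ≼* X n)
    strategic : ∀ X → X ∈ U → (G : Pred (List ℕ) 0ℓ) → [] ∈ G →
                (∀ w → w ∈ G → Meets X (λ v → Legal w v × (v ∷ w) ∈ G)) →
                ∃[ Z ] ∃[ z ] Z ∈ U × Generates z Z × (∀ k → applyDownFrom z k ∈ G)

-- Diagonalization in the filter and Ramsey's theorem for closed sets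

module Ramsey (em : ∀ {ℓ} → ExcludedMiddle ℓ) (𝕊 : Space) (U : Pred (Space.Sub 𝕊) 0ℓ)
  (filter : StrategicFilter 𝕊 U) where

  open Classical em
  open Space 𝕊
  open StrategicFilter filter

  abstract
    -- Successive common lower bounds turn the sequence into a decreasing one, to which (p) applies.
    pseudoIntersection : (X : ℕ → Sub) → (∀ n → X n ∈ U) → ∃[ Y ] Y ∈ U × (∀ n → Y ≼* X n)
    pseudoIntersection X X∈U =
      let Y , Y∈U , Y≼* = pseudo (proj₁ ∘ W) (proj₁ ∘ proj₂ ∘ W) W-decreasing
      in Y , Y∈U , λ n → ≼*-≼-trans (Y≼* n) (proj₂ (proj₂ (W n)))
      where
      W : ∀ n → ∃[ Y ] Y ∈ U × Y ≼ X n
      W zero    = X 0 , X∈U 0 , id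
      W (suc n) = let Z , Z∈U , _ , Z≼X = meet (proj₁ (proj₂ (W n))) (X∈U (suc n)) in Z , Z∈U , Z≼X

      W-decreasing : ∀ n → proj₁ (W (suc n)) ≼ proj₁ (W n)
      W-decreasing n = proj₁ (proj₂ (proj₂ (meet (proj₁ (proj₂ (W n))) (X∈U (suc n)))))

  abstract
    -- For each `i`, take a member of `U` with `P i` if there is one and an arbitrary member
    -- otherwise. A pseudo-intersection inherits all the properties attained.
    diagonal : {I : Set} → Enumerable I → (P : I → Sub → Set ℓ) → (∀ i → Hereditary (P i)) →
               ∃[ Y ] Y ∈ U × (∀ i → ∃[ X ] X ∈ U × P i X → P i Y)
    diagonal (enum , onto) P hereditary =
      let Y , Y∈U , Y≼* = pseudoIntersection (proj₁ ∘ X) (proj₁ ∘ proj₂ ∘ X)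
      in Y , Y∈U , λ i holds → let n , eq = onto i in
         subst (λ j → P j Y) eq (hereditary (enum n) (Y≼* n)
           (proj₂ (proj₂ (X n)) (subst (λ j → ∃[ X ] X ∈ U × P j X) (sym eq) holds)))
      where
      X : ∀ n → ∃[ X ] X ∈ U × (∃[ X′ ] X′ ∈ U × P (enum n) X′ → P (enum n) X)
      X n with em {P = ∃[ X′ ] X′ ∈ U × P (enum n) X′}
      ... | yes (X′ , X′∈U , holds) = X′ , X′∈U , λ _ → holds
      ... | no fails = proj₁ inhabited , proj₂ inhabited , λ holds → contradiction holds fails

  abstract
    positions : Enumerable (List ℕ)
    positions = enum-List enum-ℕ

  -- In Leave T Y w, player I can force the play out of T from w, on Y.
  data Leave (T : Pred (List ℕ) 0ℓ) (Y : Sub) (w : List ℕ) : Set where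
    out  : w ∉ T → Leave T Y w
    move : ∀ N → (∀ {v} → Y ∋ v → Above N v → Legal w v → Leave T Y (v ∷ w)) → Leave T Y w

  Leave-hereditary : ∀ {T w} → Hereditary (λ Y → Leave T Y w)
  Leave-hereditary Y′≼*Y (out w∉T) = out w∉T
  Leave-hereditary Y′≼*Y@(M , transfer) (move N leave) = move (M ⊔ N) λ ∋v above legal →
    Leave-hereditary Y′≼*Y (leave (transfer ∋v (Above-mono (m≤m⊔n M N) above))
                                  (Above-mono (m≤n⊔m M N) above) legal)

  module _ (T : Pred (List ℕ) 0ℓ) where

    private
      Lost : Pred (List ℕ) 0ℓ
      Lost w = ∃[ Y ] Y ∈ U × Leave T Y w

      -- Otherwise every `Y` in `U` has some `Z ≼ Y` whose legal vectors all lead to lost positions.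
      -- Fullness puts such a `Z` in `U`; below it and below a `Y*` that works for all lost
      -- positions at once, `w` itself is lost.
      survive : ∀ w → ¬ Lost w → ∃[ Y ] Y ∈ U × Meets Y (λ v → Legal w v × ¬ Lost (v ∷ w))
      survive w ¬lost = dne λ none →
        let Y* , Y*∈U , uniform = diagonal positions (λ w Y → Leave T Y w) (λ _ → Leave-hereditary)
            Z , Z∈U , Z⊆D = full D Y* Y*∈U λ Y Y∈U _ → dne λ ¬inside →
              none (Y , Y∈U , λ Z Z≼Y → dne λ ¬escape → ¬inside (Z , Z≼Y , λ {v} Z∋v legal →
                dne λ ¬lost′ → ¬escape (v , Z∋v , legal , ¬lost′)))
            W , W∈U , W≼Y* , W≼Z = meet Y*∈U Z∈U
        in ¬lost (W , W∈U , move 0 λ {v} W∋v _ legal →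
             Leave-hereditary (≼⇒≼* W≼Y*) (uniform (v ∷ w) (Z⊆D (W≼Z W∋v) legal)))
        where
        D : Pred ℕ 0ℓ
        D v = Legal w v → Lost (v ∷ w)

    abstract
      -- If `[]` is not lost, `survive` lets player II move among positions that are not lost, and
      -- one `X` in `U` serves all of them, so `strategic` yields such a play with outcome in `U`. A
      -- position outside `T` would be lost by `out`.
      closedRamsey : Lost [] ⊎ ∃[ Z ] ∃[ z ] Z ∈ U × Generates z Z × (∀ k → applyDownFrom z k ∈ T)
      closedRamsey with em {P = Lost []}
      ... | yes lost = inj₁ lost
      ... | no ¬lost =
        let X , X∈U , uniform = diagonal positions
              (λ w Y → Meets Y (λ v → Legal w v × ¬ Lost (v ∷ w))) (λ w → Meets-hereditary)
            Z , z , Z∈U , generates , inside = strategic X X∈U (λ w → ¬ Lost w) ¬lost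
              (λ w ¬lost → uniform w (survive w ¬lost))
        in inj₂ (Z , z , Z∈U , generates , λ k → dne λ ∉T →
             inside k (proj₁ inhabited , proj₂ inhabited , out ∉T))

  -- Player I may be restricted to members of U: player II's replies depend
  -- only on the position, so the plays of II's strategy form a closed set.
  module _ {St : Set} (s₀ : St) (Inv : List ℕ → St → Set) (Trans : List ℕ → St → St → Set)
    (start : Inv [] s₀)
    (next : ∀ w s → Inv w s → ∀ Y → Y ∈ U →
            ∃[ v ] Y ∋ v × Legal w v × (∃[ s′ ] Inv (v ∷ w) s′ × Trans w s s′)) where

    private
      Good : List ℕ → St → ℕ → Set
      Good w s v = ∃[ s′ ] Inv (v ∷ w) s′ × Trans w s s′

      state : List ℕ → St
      state [] = s₀
      state (v ∷ w) with em {P = Good w (state w) v}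
      ... | yes (s′ , _) = s′
      -- Never reached at positions in `T`, where every move is `Good`.
      ... | no _         = s₀

      state-∷ : ∀ v w → Good w (state w) v →
                Inv (v ∷ w) (state (v ∷ w)) × Trans w (state w) (state (v ∷ w))
      state-∷ v w good with em {P = Good w (state w) v}
      ... | yes (_ , holds) = holds
      ... | no ¬good        = contradiction good ¬good

      T : Pred (List ℕ) 0ℓ
      T []      = ⊤
      T (v ∷ w) = T w × Good w (state w) v

      T⇒Inv : ∀ w → T w → Inv w (state w)
      T⇒Inv []      _          = start
      T⇒Inv (v ∷ w) (_ , good) = proj₁ (state-∷ v w good)

      -- Against the number `N` player II replies to the tail beyond `N`, a member of `U`, and
      -- remains in `T`. As `Leave` is well-founded, this cannot go on.
      stays : ∀ {Y} → Y ∈ U → ∀ w → T w → ¬ Leave T Y w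
      stays Y∈U w w∈T (out w∉T) = w∉T w∈T
      stays Y∈U w w∈T (move N leave) =
        let v , ∋v , legal , good = next w (state w) (T⇒Inv w w∈T) _ (tail∈ {N = N} Y∈U)
        in stays Y∈U (v ∷ w) (w∈T , good) (leave (tail-∋ ∋v) (tail-Above ∋v) legal)

    abstract
      restrictedStrategic : ∃[ Z ] ∃[ z ] Z ∈ U × Generates z Z ×
        (Σ[ st ∈ (ℕ → St) ] ∀ k → Inv (applyDownFrom z k) (st k) ×
                                 Trans (applyDownFrom z k) (st k) (st (suc k)))
      restrictedStrategic with closedRamsey T
      ... | inj₁ (Y , Y∈U , leave) = contradiction leave (stays Y∈U [] tt)
      ... | inj₂ (Z , z , Z∈U , generates , inside) =
        Z , z , Z∈U , generates , (λ k → state (applyDownFrom z k)) , λ k →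
          T⇒Inv _ (inside k) , proj₂ (state-∷ _ _ (proj₂ (inside (suc k))))

  finiteMeet : ∀ n (g : List Bool → Sub) → (∀ t → g t ∈ U) →
               ∃[ Z ] Z ∈ U × (∀ t → length t ≡ n → Z ≼ g t)
  finiteMeet zero    g g∈U = g [] , g∈U [] , λ { [] refl → id }
  finiteMeet (suc n) g g∈U =
    let Z₀ , Z₀∈U , Z₀≼ = finiteMeet n (g ∘ (false ∷_)) (g∈U ∘ (false ∷_))
        Z₁ , Z₁∈U , Z₁≼ = finiteMeet n (g ∘ (true ∷_)) (g∈U ∘ (true ∷_))
        Z , Z∈U , Z≼Z₀ , Z≼Z₁ = meet Z₀∈U Z₁∈U
    in Z , Z∈U , λ { (false ∷ t) refl ∋v → Z₀≼ t refl (Z≼Z₀ ∋v)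
                   ; (true ∷ t) refl ∋v → Z₁≼ t refl (Z≼Z₁ ∋v) }

  -- The perfect dichotomy for closed sets of vectors

  ClosedOn : Tree → (Cantor → Pred ℕ 0ℓ) → Set
  ClosedOn p D = ∀ f v → Branches p f → v ∉ D f →
    ∃[ n ] ∀ f′ → Branches p f′ → applyUpTo f′ n ≡ applyUpTo f n → v ∉ D f′

  module _ (D : Cantor → Pred ℕ 0ℓ) where

    Inside : Tree → Sub → Set
    Inside q Y = ∀ f → Branches q f → ∀ {v} → Y ∋ v → v ∈ D f

    Escaping : Tree → Sub → Set
    Escaping q Y = ∀ f → Branches q f → Meets Y (λ v → v ∉ D f)

    -- Suppose that no q, Y as in the second alternative exist.  Closed Ramsey
    -- and compactness of [q] show that every q has a branch f with ⟨Z⟩ ⊆ D f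
    -- for some Z ∈ U.  Let Q w f say that ⟨w , Z⟩ ⊆ D f for some Z ∈ U.  After
    -- thinning p, no Q w has an isolated branch, so a strategy for II can
    -- build a Cantor scheme in Q w along with the position w, and a play of it
    -- with outcome in U gives the first alternative.
    module _ (p : PerfectTree) (closed-D : ClosedOn (proj₁ p) D)
      (unavoidable : ∀ (q : PerfectTree) → q ≤ᵀ p → ∀ Y → Y ∈ U → ¬ Escaping (proj₁ q) Y) where

      private
        Captured : Tree → Pred Sub 0ℓ → Set
        Captured q V = ∃[ f ] Branches q f × ∃[ Z ] Z ∈ V × (∀ {v} → Z ∋ v → v ∈ D f)

        capture : ∀ (q : PerfectTree) → q ≤ᵀ p → ∀ Y → Y ∈ U → Captured (proj₁ q) (_≼ Y)
        capture q q≤p Y Y∈U = dne {P = Captured (proj₁ q) (_≼ Y)} λ none →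
          unavoidable q q≤p Y Y∈U λ f f∈q Z Z≼Y → dne λ inside → none (f , f∈q , Z , Z≼Y , λ {v} Z∋v → dne λ v∉D → inside (v , Z∋v , v∉D))

        T : Tree → Pred (List ℕ) 0ℓ
        T q w = ∃[ f ] Branches q f × Span (_∈ˡ w) ⊆ D f

        -- Player II plays inside `Z`: the span of the position then stays within ⟨Z⟩, hence within
        -- `D f` for the one branch `f`.
        captured-stays : ∀ q {Y f Z} → Branches q f → Z ≼ Y → (∀ {v} → Z ∋ v → v ∈ D f) →
                         ∀ w → (∀ {v} → v ∈ˡ w → Z ∋ v) → ¬ Leave (T q) Y w
        captured-stays q {Z = Z} f∈q Z≼Y Z⊆D w w⊆Z (out w∉T) =
          w∉T (_ , f∈q , λ span → Z⊆D (Span-closed Z (Span-mono w⊆Z span)))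
        captured-stays q {Z = Z} f∈q Z≼Y Z⊆D w w⊆Z (move N leave) =
          let v , ∋v , legal = legal-exists w (tail Z N)
          in captured-stays q f∈q Z≼Y Z⊆D (v ∷ w)
               (λ { (here refl) → tail-∋ ∋v ; (there v∈w) → w⊆Z v∈w })
               (leave (Z≼Y (tail-∋ ∋v)) (tail-Above ∋v) legal)

        span-mono : ∀ (z : ℕ → ℕ) {j k} → j ≤ k →
                    Span (_∈ˡ applyDownFrom z j) ⊆ Span (_∈ˡ applyDownFrom z k)
        span-mono z j≤k = Span-mono (weaken j≤k)
          where
          weaken : ∀ {j k v} → j ≤ k → v ∈ˡ applyDownFrom z j → v ∈ˡ applyDownFrom z k
          weaken {j} {k} j≤k v∈ with j ≟ k
          ... | yes refl = v∈
          weaken {j} {zero} z≤n () | no j≢k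
          weaken {j} {suc k} j≤k v∈ | no j≢k = there (weaken (≤-pred (≤∧≢⇒< j≤k j≢k)) v∈)

        limit-inside : ∀ q {f v} → q ⊆ proj₁ p → Branches q f →
          (∀ n → ∃[ f′ ] Branches q f′ × applyUpTo f′ n ≡ applyUpTo f n × v ∈ D f′) → v ∈ D f
        limit-inside q q⊆p f∈q approx = dne λ v∉D →
          let n , far = closed-D _ _ (λ k → q⊆p (f∈q k)) v∉D
              f′ , f′∈q , eq , v∈D = approx n
          in far f′ (λ k → q⊆p (f′∈q k)) eq v∈D

        -- The gain over `capture` is that `Z` lies in `U`. Each position of the play is captured by
        -- a branch of its own; at a cluster point of these branches, closedness captures all
        -- positions at once.
        captured-in-U : ∀ (q : PerfectTree) → q ≤ᵀ p → Captured (proj₁ q) U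
        captured-in-U q q≤p with closedRamsey (T (proj₁ q))
        ... | inj₁ (Y , Y∈U , leave) =
          let f , f∈q , Z , Z≼Y , Z⊆D = capture q q≤p Y Y∈U
          in contradiction leave (captured-stays (proj₁ q) f∈q Z≼Y Z⊆D [] λ ())
        ... | inj₂ (Z , z , Z∈U , generates , inside) =
          let f , cluster = clusterPoint (proj₁ ∘ inside)
              f∈q : Branches (proj₁ q) f
              f∈q n = let j , _ , eq = cluster n 0 in subst (proj₁ q) eq (proj₁ (proj₂ (inside j)) n)
          in f , f∈q , Z , Z∈U , λ Z∋v → let k , span = generates Z∋v in
             limit-inside (proj₁ q) q≤p f∈q λ n → let j , k≤j , eq = cluster n k in
               proj₁ (inside j) , proj₁ (proj₂ (inside j)) , eq ,
               proj₂ (proj₂ (inside j)) (span-mono z k≤j span)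

        Joined : List ℕ → Sub → Pred ℕ 0ℓ
        Joined w Z v = v ∈ˡ w ⊎ Z ∋ v

        Q : List ℕ → Cantor → Set
        Q w f = ∃[ Z ] Z ∈ U × Span (Joined w Z) ⊆ D f

        thinned = decided positions (λ w q → ∀ f → Branches q f → ¬ Q w f)
          (λ w q⊆r avoids f f∈q → avoids f (λ n → q⊆r (f∈q n))) p

        p* : PerfectTree
        p* = proj₁ thinned

        -- What was decided is that no branch has `Q w`. Near a branch with `Q w` the decision is
        -- negative, so every perfect subtree there has a branch with `Q w`, in particular one that
        -- leaves `f` at a late splitting node.
        no-isolated : ∀ w f → Branches (proj₁ p*) f → Q w f → ∀ n →
          ∃[ d ] ∃[ f′ ] n ≤ d × applyUpTo f d ≡ applyUpTo f′ d × f d ≢ f′ d ×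
                         Branches (proj₁ p*) f′ × Q w f′
        no-isolated w f f∈p* Qf n with proj₂ (proj₂ thinned) w
        ... | m , decision with decision (applyUpTo f m) (length-applyUpTo f m) (f∈p* m)
        ... | inj₁ avoids = contradiction Qf (avoids f (Branches-cut (proj₁ p*) f∈p* (⊏-applyUpTo f m)))
        ... | inj₂ never =
          let f′ , f′∈ , Qf′ = witness
              t⊏f′ = Branches-cut-⊏ (proj₁ p*) f′∈
              agree : applyUpTo f′ n ≡ applyUpTo f n
              agree = subst (λ k → applyUpTo f′ k ≡ applyUpTo f n) (length-applyUpTo f n)
                (⊏-⊑⁻ f′ (⊑-trans (⊑-applyUpTo f (m≤n⊔m m n)) (⊑-∷ʳ _ u b)) t⊏f′)
              d , n≤d , same , differ = firstDifference f f′ n (length t) (sym agree)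
                (λ eq → t⊏̸f (trans eq t⊏f′))
          in d , f′ , n≤d , same , differ , (λ k → proj₁ (f′∈ k)) , Qf′
          where
          fork = splits (proj₂ p*) (applyUpTo f (m ⊔ n)) (f∈p* (m ⊔ n))
          u = proj₁ fork
          s = applyUpTo f (m ⊔ n) ++ u
          -- The child of the splitting node that `f` does not take.
          b = not (f (length s))
          t = s ∷ʳ b

          t∈p* : t ∈ proj₁ p*
          t∈p* with f (length s)
          ... | false = proj₂ (proj₂ fork)
          ... | true  = proj₁ (proj₂ fork)

          t⊏̸f : ¬ t ⊏ f
          t⊏̸f t⊏f = not-≢ (f (length s)) (⊏-∷ʳ⁻ f t⊏f)
            where
            not-≢ : ∀ b → b ≢ not b
            not-≢ false ()
            not-≢ true  ()

          witness : ∃[ f′ ] Branches (cut (proj₁ p*) t) f′ × Q w f′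
          witness = dne λ none → never (cutᵀ p* t t∈p*)
            (cut-antitone {proj₁ p*} (⊑-trans (⊑-applyUpTo f (m≤m⊔n m n)) (⊑-∷ʳ _ u b)))
            (λ f′ f′∈ Qf′ → none (f′ , f′∈ , Qf′))

        -- A level of the Cantor scheme with a branch chosen through each node. Only indices of the
        -- length of the current position are meaningful.
        record Family : Set where
          field
            node   : List Bool → List Bool
            member : List Bool → Cantor

        open Family

        Inv : List ℕ → Family → Set
        Inv w fam = ∀ s → length s ≡ length w →
          node fam s ⊏ member fam s × Branches (proj₁ p*) (member fam s) × Q w (member fam s)

        Trans : List ℕ → Family → Family → Set
        Trans w fam fam′ = ∀ s → length s ≡ length w →
          ∃[ u ] ∀ b → node fam′ (b ∷ s) ≡ (node fam s ++ u) ∷ʳ b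

        -- The level has finitely many members, so some `W` in `U` lies below `Y` and below all
        -- their witnesses of `Q w`. A vector `v` of `W` keeps `Q (v ∷ w)` for every member, and
        -- `no-isolated` then supplies each member with a partner.
        extendFamily : ∀ w fam → Inv w fam → ∀ Y → Y ∈ U →
          ∃[ v ] Y ∋ v × Legal w v × (∃[ fam′ ] Inv (v ∷ w) fam′ × Trans w fam fam′)
        extendFamily w fam inv Y Y∈U = v , W≼Y W∋v , legal , fam′ , inv′ , trans′
          where
          Witness : List Bool → Sub → Set
          Witness s Z = length s ≡ length w → Span (Joined w Z) ⊆ D (member fam s)

          choose : ∀ s → ∃[ Z ] Z ∈ U × Witness s Z
          choose s with length s ≟ length w
          ... | yes eq = let Z , Z∈U , inside = proj₂ (proj₂ (inv s eq)) in Z , Z∈U , λ _ → inside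
          ... | no neq = Y , Y∈U , λ eq → contradiction eq neq

          common = finiteMeet (length w) (proj₁ ∘ choose) (proj₁ ∘ proj₂ ∘ choose)
          below = meet Y∈U (proj₁ (proj₂ common))
          W = proj₁ below
          W≼Y : W ≼ Y
          W≼Y = proj₁ (proj₂ (proj₂ below))
          v = proj₁ (legal-exists w W)
          W∋v = proj₁ (proj₂ (legal-exists w W))
          legal = proj₂ (proj₂ (legal-exists w W))

          Q-∷ : ∀ s → length s ≡ length w → Q (v ∷ w) (member fam s)
          Q-∷ s eq = W , proj₁ (proj₂ below) , λ span → proj₂ (proj₂ (choose s)) eq (Span-mono join span)
            where
            W≼ : W ≼ proj₁ (choose s)
            W≼ W∋u = proj₂ (proj₂ common) s eq (proj₂ (proj₂ (proj₂ below)) W∋u)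
            join : Joined (v ∷ w) W ⊆ Joined w (proj₁ (choose s))
            join (inj₁ (here refl)) = inj₂ (W≼ W∋v)
            join (inj₁ (there u∈w)) = inj₁ u∈w
            join (inj₂ W∋u)         = inj₂ (W≼ W∋u)

          Split : List Bool → ℕ → Cantor → Set
          Split s d f′ = let f = member fam s in
            length s ≡ length w → length (node fam s) ≤ d × applyUpTo f d ≡ applyUpTo f′ d × f d ≢ f′ d ×
                                  Branches (proj₁ p*) f′ × Q (v ∷ w) f′

          split : ∀ s → ∃[ d ] ∃[ f′ ] Split s d f′
          split s with length s ≟ length w
          ... | yes eq =
            let d , f′ , holds = no-isolated (v ∷ w) (member fam s) (proj₁ (proj₂ (inv s eq)))
                                   (Q-∷ s eq) (length (node fam s))
            in d , f′ , λ _ → holds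
          ... | no neq = 0 , member fam s , λ eq → contradiction eq neq

          level : List Bool → ℕ
          level s = proj₁ (split s)

          data Choice (s : List Bool) (b : Bool) : Set where
            keep   : member fam s (level s) ≡ b → Choice s b
            switch : member fam s (level s) ≢ b → Choice s b

          choice : ∀ s b → Choice s b
          choice s b with em {P = member fam s (level s) ≡ b}
          ... | yes eq = keep eq
          ... | no neq = switch neq

          select : ∀ {s b} → Choice s b → Cantor
          select {s} (keep _)   = member fam s
          select {s} (switch _) = proj₁ (proj₂ (split s))

          fam′ : Family
          fam′ .node []       = []
          -- Up to `level s` a member and its partner agree, so both new nodes extend the old one;
          -- the bit `b` tells them apart.
          fam′ .node (b ∷ s)  = applyUpTo (member fam s) (level s) ∷ʳ b
          fam′ .member []      = member fam []
          fam′ .member (b ∷ s) = select (choice s b)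

          ⊏-∷ʳ : ∀ (f : Cantor) {g d b} → applyUpTo g d ≡ applyUpTo f d → g d ≡ b →
                 (applyUpTo f d ∷ʳ b) ⊏ g
          ⊏-∷ʳ f {g} {d} {b} same at = ⊏-∷ʳ⁺ g
            (trans (cong (applyUpTo g) (length-applyUpTo f d)) same)
            (trans (cong g (length-applyUpTo f d)) at)

          other : ∀ {a b c : Bool} → a ≢ b → a ≢ c → c ≡ b
          other {false} {false} a≢b _ = contradiction refl a≢b
          other {false} {true} {false} _ a≢c = contradiction refl a≢c
          other {false} {true} {true} _ _ = refl
          other {true} {true} a≢b _ = contradiction refl a≢b
          other {true} {false} {true} _ a≢c = contradiction refl a≢c
          other {true} {false} {false} _ _ = refl

          inv′ : Inv (v ∷ w) fam′
          inv′ (b ∷ s) eq with choice s b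
          ... | keep at = ⊏-∷ʳ (member fam s) refl at , proj₁ (proj₂ (inv s eq′)) , Q-∷ s eq′
            where eq′ = suc-injective eq
          ... | switch at =
            let _ , same , differ , f′∈ , Qf′ = proj₂ (proj₂ (split s)) (suc-injective eq)
            in ⊏-∷ʳ (member fam s) (sym same) (other at differ) , f′∈ , Qf′

          trans′ : Trans w fam fam′
          trans′ s eq =
            let le , _ = proj₂ (proj₂ (split s)) eq
                u , eqᵤ = ⊏-⊑ (member fam s) (proj₁ (inv s eq)) le
            in u , λ b → cong (_∷ʳ b) (sym eqᵤ)

        start : ∃[ fam ] Inv [] fam
        start =
          let f , f∈p* , Z , Z∈U , Z⊆D = captured-in-U p* (proj₁ (proj₂ thinned))
          in record { node = λ _ → [] ; member = λ _ → f } , λ s _ →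
               refl , f∈p* , Z , Z∈U , λ span → Z⊆D (Span-closed Z (Span-mono (λ { (inj₂ Z∋v) → Z∋v }) span))

      perfectlyInside : Σ[ q ∈ PerfectTree ] q ≤ᵀ p × ∃[ Y ] Y ∈ U × Inside (proj₁ q) Y
      perfectlyInside with restrictedStrategic (proj₁ start) Inv Trans (proj₂ start) extendFamily
      ... | Z , z , Z∈U , generates , st , run =
        (tree , isPerfect) , tree⊆p , Z , Z∈U , inside
        where
        len : ∀ s → length s ≡ length (applyDownFrom z (length s))
        len s = sym (length-applyDownFrom z (length s))

        gap : ∀ s → ∃[ u ] ∀ b → node (st (suc (length s))) (b ∷ s) ≡ (node (st (length s)) s ++ u) ∷ʳ b
        gap s = proj₂ (run (length s)) s (len s)

        -- Each node is read off the family of the round that has the length of its index.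
        open Scheme (λ s → node (st (length s)) s) (proj₁ ∘ gap) (λ b s → proj₂ (gap s) b)

        memberAt : List Bool → Cantor
        memberAt s = member (st (length s)) s

        memberAt-inv = λ s → proj₁ (run (length s)) s (len s)

        tree⊆p* : tree ⊆ proj₁ p*
        tree⊆p* {t} (s , t⊑) =
          let N⊏ , f∈ , _ = memberAt-inv s
          in subst (proj₁ p*) (⊏-⊑⁻ (memberAt s) t⊑ N⊏) (f∈ (length t))

        tree⊆p : tree ⊆ proj₁ p
        tree⊆p t∈ = proj₁ (proj₂ thinned) (tree⊆p* t∈)

        -- Branches of the tree are limits of members of late families only,
        -- as a long node has a long index.
        inside : Inside tree Z
        inside f f∈ Z∋v = let k , span = generates Z∋v in
          limit-inside (proj₁ p*) (proj₁ (proj₂ thinned)) (λ n → tree⊆p* (f∈ n)) λ n →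
            let r , s , len-s , f⊑ = through k (f∈ n)
                N⊏ , f′∈ , (Z′ , _ , inside′) = memberAt-inv (r ++ s)
                k≤ : k ≤ length (r ++ s)
                k≤ = subst₂ _≤_ len-s (sym (length-++ r)) (m≤n+m _ _)
            in memberAt (r ++ s) , f′∈ ,
               subst (λ j → applyUpTo (memberAt (r ++ s)) j ≡ applyUpTo f n) (length-applyUpTo f n)
                 (⊏-⊑⁻ (memberAt (r ++ s)) f⊑ N⊏) ,
               inside′ (Span-mono inj₁ (span-mono z k≤ span))

    abstract
      perfectDichotomy : ∀ (p : PerfectTree) → ClosedOn (proj₁ p) D →
        Σ[ q ∈ PerfectTree ] q ≤ᵀ p × ∃[ Y ] Y ∈ U × (Inside (proj₁ q) Y ⊎ Escaping (proj₁ q) Y)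
      perfectDichotomy p closed-D
        with em {P = Σ[ q ∈ PerfectTree ] q ≤ᵀ p × ∃[ Y ] Y ∈ U × Escaping (proj₁ q) Y}
      ... | yes (q , q≤p , Y , Y∈U , escaping) = q , q≤p , Y , Y∈U , inj₂ escaping
      ... | no none =
        let q , q≤p , Y , Y∈U , inside = perfectlyInside p closed-D
              (λ q q≤p Y Y∈U escaping → none (q , q≤p , Y , Y∈U , escaping))
        in q , q≤p , Y , Y∈U , inj₁ inside

  -- Reachability and winning strategies for player II

  mutual
    -- In Reach T Y w, player II can force the play into T, in at least one
    -- move from w, when player I plays below Y.
    data Reach (T : Pred (List ℕ) 0ℓ) (Y : Sub) (w : List ℕ) : Set where
      reach : (∀ Z → Z ≼ Y → ReachStep T Y w Z) → Reach T Y w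

    data ReachStep (T : Pred (List ℕ) 0ℓ) (Y : Sub) (w : List ℕ) (Z : Sub) : Set where
      stop : ∀ v → Z ∋ v → Legal w v → (v ∷ w) ∈ T → ReachStep T Y w Z
      go   : ∀ v → Z ∋ v → Legal w v → Reach T Y (v ∷ w) → ReachStep T Y w Z

  mutual
    Reach-hereditary : ∀ {T w} → Hereditary (λ Y → Reach T Y w)
    Reach-hereditary Y′≼*Y@(N , transfer) (reach step) = reach λ Z Z≼Y′ →
      ReachStep-hereditary Y′≼*Y (step (tail Z N) λ ∋v → transfer (Z≼Y′ (tail-∋ ∋v)) (tail-Above ∋v))

    ReachStep-hereditary : ∀ {T w Y′ Y Z N} → Y′ ≼* Y → ReachStep T Y w (tail Z N) → ReachStep T Y′ w Z
    ReachStep-hereditary Y′≼*Y (stop v ∋v legal v∈T) = stop v (tail-∋ ∋v) legal v∈T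
    ReachStep-hereditary Y′≼*Y (go v ∋v legal r) = go v (tail-∋ ∋v) legal (Reach-hereditary Y′≼*Y r)

  FOutcome : List ℕ → Sub → (List ℕ → ℕ) → Pred (ℕ → ℕ) 0ℓ
  FOutcome w Y σ z = applyDownFrom z (length w) ≡ w ×
    (∀ k → length w ≤ k → Y ∋ z k × Legal (applyDownFrom z k) (z k) × Above (σ (applyDownFrom z k)) (z k))

  FOutcome-mono : ∀ {w Y σ σ′ z} → (∀ u → σ u ≤ σ′ u) → FOutcome w Y σ′ z → FOutcome w Y σ z
  FOutcome-mono σ≤ (start , play) = start , λ k le →
    let ∋z , legal , above = play k le in ∋z , legal , Above-mono (σ≤ _) above

  -- States are kept apart from positions, since replies may depend on more than the vectors played,
  -- such as the digits of a witness found so far.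
  record WinningII (w₀ : List ℕ) (Y : Sub) (Win : Pred (ℕ → ℕ) 0ℓ) : Set₁ where
    field
      State    : Set
      initial  : State
      position : State → List ℕ
      next     : ∀ s Z → Z ≼ Y →
                 ∃[ v ] Z ∋ v × Legal (position s) v × (∃[ s′ ] position s′ ≡ v ∷ position s)

    after : ∀ s Z → Z ≼ Y → State
    after s Z Z≼Y = proj₁ (proj₂ (proj₂ (proj₂ (next s Z Z≼Y))))

    field
      position-initial : position initial ≡ w₀
      wins : ∀ (st : ℕ → State) z → st 0 ≡ initial →
             (∀ k → ∃[ Z ] Σ[ Z≼Y ∈ Z ≼ Y ] st (suc k) ≡ after (st k) Z Z≼Y) →
             (∀ k → applyDownFrom z (length w₀ + k) ≡ position (st k)) →
             (∀ k → length w₀ ≤ k → Legal (applyDownFrom z k) (z k)) → z ∈ Win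

  -- The dichotomy for projections of closed sets

  module Parametrized (C : Cantor → (ℕ → ℕ) → (ℕ → ℕ) → Set) (w₀ : List ℕ)
    -- Closedness is asked at legal plays extending `w₀`: these are the `z` that code block
    -- sequences.
    (C-closed : ∀ f z g → (∀ k → length w₀ ≤ k → Legal (applyDownFrom z k) (z k)) →
      applyDownFrom z (length w₀) ≡ w₀ →
      (∀ n → ∃[ f′ ] ∃[ z′ ] ∃[ g′ ] C f′ z′ g′ × (∀ k → k < n → f k ≡ f′ k × z k ≡ z′ k × g k ≡ g′ k)) →
      C f z g)
    (X : Sub) (X∈U : X ∈ U) (p : PerfectTree) where

    private
      Index : Set
      Index = List ℕ × List ℕ

      abstract
        indices : Enumerable Index
        indices = enum-× positions positions

      -- Digits of the witness g are listed with the latest first, too.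
      Hit : List ℕ → Cantor → (ℕ → ℕ) → Set
      Hit s f z = ∃[ g ] applyDownFrom g (length s) ≡ s × C f z g

      Avoids : Index → Tree → Sub → Set
      Avoids (w , s) q Y = ∃[ σ ] ∀ f → Branches q f → ∀ z → FOutcome w Y σ z → ¬ Hit s f z

      Avoids-hereditary : ∀ i q → Hereditary (Avoids i q)
      Avoids-hereditary i q (N , transfer) (σ , avoids) = (λ u → N ⊔ σ u) , λ f f∈q z (start , play) →
        avoids f f∈q z (start , λ k le →
          let ∋z , legal , above = play k le
          in transfer ∋z (Above-mono (m≤m⊔n N _) above) , legal , Above-mono (m≤n⊔m N _) above)

      Avoidable : Index → Tree → Set
      Avoidable i q = ∃[ Y ] Y ∈ U × Avoids i q Y

      module D₁ = Decided indices Avoidable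
        (λ i q⊆p (Y , Y∈U , σ , avoids) → Y , Y∈U , σ , λ f f∈q → avoids f (λ n → q⊆p (f∈q n))) p

      q₁ = D₁.q

      WonByI : Cantor → List ℕ → List ℕ → Set
      WonByI f w s = D₁.Eventual (w , s) f

      -- Bounding the new digit by the length of the position leaves finitely
      -- many strategies for player I to join at each position.
      Target : Cantor → List ℕ → Pred (List ℕ) 0ℓ
      Target f s w = ∃[ n ] n ≤ length w × ¬ WonByI f w (n ∷ s)

      ReachesOn : Index → Tree → Sub → Set
      ReachesOn (w , s) q Y = ∀ f → Branches q f → Reach (Target f s) Y w

      Reachable : Index → Tree → Set
      Reachable i q = ∃[ Y ] Y ∈ U × ReachesOn i q Y

      module D₂ = Decided indices Reachable
        (λ i q⊆p (Y , Y∈U , r) → Y , Y∈U , λ f f∈q → r f (λ n → q⊆p (f∈q n))) q₁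

      q₂ = D₂.q

      Reaches : Cantor → List ℕ → List ℕ → Set
      Reaches f w s = D₂.Eventual (w , s) f

      -- The sets to which the vector dichotomy is applied: `Inside` lets player I keep the play off
      -- the targets, `Escaping` gives player II the first move of a `Reach`.
      Safe : Index → Cantor → Pred ℕ 0ℓ
      Safe (w , s) f v = Legal w v → ¬ (Target f s (v ∷ w) ⊎ Reaches f (v ∷ w) s)

      -- Both ways of being unsafe are open in the branch: a target by locality of failure of
      -- `WonByI`, a position that `Reaches` because one node of `f` witnesses it.
      Safe-closed : ∀ i (q : PerfectTree) → q ≤ᵀ q₂ → ClosedOn (proj₁ q) (Safe i)
      Safe-closed (w , s) q q≤ f v f∈q unsafe = local (dne λ ¬target → unsafe λ legal target → ¬target target)
        where
        legal : Legal w v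
        legal = dne λ ¬legal → unsafe λ legal → contradiction legal ¬legal

        local : Target f s (v ∷ w) ⊎ Reaches f (v ∷ w) s →
          ∃[ n ] ∀ f′ → Branches (proj₁ q) f′ → applyUpTo f′ n ≡ applyUpTo f n → v ∉ Safe (w , s) f′
        local (inj₁ (n , n≤ , ¬won)) = D₁.level (v ∷ w , n ∷ s) , λ f′ f′∈q same safe →
          safe legal (inj₁ (n , n≤ , D₁.¬eventual-local (v ∷ w , n ∷ s) {f} {f′}
            (λ k → D₂.q≤p (q≤ (f′∈q k))) same ¬won))
        local (inj₂ (n , r)) = n , λ f′ f′∈q same safe →
          safe legal (inj₂ (n , subst (λ t → Reachable (v ∷ w , s) (cut (proj₁ q₂) t)) (sym same) r))

      Settled : Index → Tree → Set
      Settled i q = ∃[ Y ] Y ∈ U × (Inside (Safe i) q Y ⊎ Escaping (Safe i) q Y)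

      Settled-hereditary : ∀ i {p q} → q ⊆ p → Settled i p → Settled i q
      Settled-hereditary i q⊆p (Y , Y∈U , inj₁ inside) =
        Y , Y∈U , inj₁ λ f f∈q → inside f (λ n → q⊆p (f∈q n))
      Settled-hereditary i q⊆p (Y , Y∈U , inj₂ escaping) =
        Y , Y∈U , inj₂ λ f f∈q → escaping f (λ n → q⊆p (f∈q n))

      abstract
        settled : Σ[ q ∈ PerfectTree ] q ≤ᵀ q₂ ×
                  (∀ i → ∃[ m ] ∀ t → length t ≡ m → t ∈ proj₁ q → Settled i (cut (proj₁ q) t))
        settled = fusion indices Settled Settled-hereditary q₂
          λ i q q≤ → perfectDichotomy (Safe i) q (Safe-closed i q q≤)

      q₃ = proj₁ settled

      q₃≤q₂ : q₃ ≤ᵀ q₂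
      q₃≤q₂ = proj₁ (proj₂ settled)

      level₃ : Index → ℕ
      level₃ i = proj₁ (proj₂ (proj₂ settled) i)

      settledAt : ∀ i f → Branches (proj₁ q₃) f → Settled i (cut (proj₁ q₃) (applyUpTo f (level₃ i)))
      settledAt i f f∈ = proj₂ (proj₂ (proj₂ settled) i) _ (length-applyUpTo f _) (f∈ _)

      into₂ : ∀ {f} → Branches (proj₁ q₃) f → Branches (proj₁ q₂) f
      into₂ f∈ n = q₃≤q₂ (f∈ n)

      into₁ : ∀ {f} → Branches (proj₁ q₃) f → Branches (proj₁ q₁) f
      into₁ f∈ n = D₂.q≤p (into₂ f∈ n)

      -- The two Booleans name the four kinds of property required of one `Y`; as a product of
      -- enumerable types, the demands can be diagonalized.
      Demand : Set
      Demand = (Bool × Bool) × Index × List Bool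

      Meeting : Demand → Sub → Set
      Meeting ((false , false) , i , t) Y = Avoids i (cut (proj₁ q₁) t) Y
      Meeting ((false , true)  , i , t) Y = ReachesOn i (cut (proj₁ q₂) t) Y
      Meeting ((true  , false) , i , t) Y = Escaping (Safe i) (cut (proj₁ q₃) t) Y
      -- `Inside` does not pass to `≼*`-smaller sequences; holding from some point on does.
      Meeting ((true  , true)  , i , t) Y =
        Eventually Y (λ v → ∀ f → Branches (cut (proj₁ q₃) t) f → v ∈ Safe i f)

      Meeting-hereditary : ∀ d → Hereditary (Meeting d)
      Meeting-hereditary ((false , false) , i , t) = Avoids-hereditary i (cut (proj₁ q₁) t)
      Meeting-hereditary ((false , true)  , i , t) Y′≼*Y r f f∈ = Reach-hereditary Y′≼*Y (r f f∈)
      Meeting-hereditary ((true  , false) , i , t) Y′≼*Y esc f f∈ = Meets-hereditary Y′≼*Y (esc f f∈)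
      Meeting-hereditary ((true  , true)  , i , t) = Eventually-hereditary

      abstract
        uniform : ∃[ Y ] Y ∈ U × Y ≼ X × (∀ d → ∃[ Y′ ] Y′ ∈ U × Meeting d Y′ → Meeting d Y)
        uniform =
          let Y* , Y*∈U , meeting = diagonal
                (enum-× (enum-× enum-Bool enum-Bool) (enum-× indices (enum-List enum-Bool)))
                Meeting Meeting-hereditary
              Y , Y∈U , Y≼Y* , Y≼X = meet Y*∈U X∈U
          in Y , Y∈U , Y≼X , λ d holds → Meeting-hereditary d (≼⇒≼* Y≼Y*) (meeting d holds)

      Y : Sub
      Y = proj₁ uniform

      Y∈U : Y ∈ U
      Y∈U = proj₁ (proj₂ uniform)

      attain : ∀ d → ∃[ Y′ ] Y′ ∈ U × Meeting d Y′ → Meeting d Y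
      attain = proj₂ (proj₂ (proj₂ uniform))

      -- The strategies for the finitely many nodes at `D₁.level i` are joined by a maximum, as
      -- larger numbers only restrict player II further. The joined strategy no longer depends on
      -- `f`.
      joinedStrategy : ∀ i → ∃[ σ ] ∀ f → Branches (proj₁ q₁) f → WonByI f (proj₁ i) (proj₂ i) →
                       ∀ z → FOutcome (proj₁ i) Y σ z → ¬ Hit (proj₂ i) f z
      joinedStrategy i = (λ u → maxOver (D₁.level i) (λ t → σ t u)) , λ f f∈ won z out →
        let t = applyUpTo f (D₁.level i) in
        σ-avoids t (D₁.eventual-level i f∈ won) f (Branches-cut (proj₁ q₁) f∈ (⊏-applyUpTo f _)) z
          (FOutcome-mono (λ u → ≤-maxOver (λ t → σ t u) t (length-applyUpTo f (D₁.level i))) out)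
        where
        choose : ∀ t → ∃[ σ ] (Avoidable i (cut (proj₁ q₁) t) → ∀ f → Branches (cut (proj₁ q₁) t) f →
                              ∀ z → FOutcome (proj₁ i) Y σ z → ¬ Hit (proj₂ i) f z)
        choose t with em {P = Avoidable i (cut (proj₁ q₁) t)}
        ... | yes avoidable = let σ , avoids = attain ((false , false) , i , t) avoidable in σ , λ _ → avoids
        ... | no ¬avoidable = (λ _ → 0) , λ avoidable → contradiction avoidable ¬avoidable

        σ : List Bool → List ℕ → ℕ
        σ t = proj₁ (choose t)

        σ-avoids = λ t → proj₂ (choose t)

      reach-on-Y : ∀ f w s → Branches (proj₁ q₂) f → Reaches f w s → Reach (Target f s) Y w
      reach-on-Y f w s f∈ (n , reachable) = attain ((false , true) , (w , s) , applyUpTo f n) reachable f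
        (Branches-cut (proj₁ q₂) f∈ (⊏-applyUpTo f n))

      -- An unsafe vector leads to a target or to a position from which one is reached, and on the
      -- common `Y` the latter continues as a `Reach`. `eventual-refine` carries the conclusion from
      -- `q₃` back to `q₂`.
      escaping⇒reaches : ∀ i f → Branches (proj₁ q₃) f → ∃[ Y′ ] Y′ ∈ U ×
        Escaping (Safe i) (cut (proj₁ q₃) (applyUpTo f (level₃ i))) Y′ → Reaches f (proj₁ i) (proj₂ i)
      escaping⇒reaches i@(w , s) f f∈ escaping =
        D₂.level i , D₂.eventual-refine q₃ q₃≤q₂ i f∈ (level₃ i) (Y , Y∈U , λ f′ f′∈ → reach λ Z Z≼Y →
          let v , ∋v , unsafe = attain ((true , false) , i , applyUpTo f (level₃ i)) escaping f′ f′∈ Z Z≼Y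
          in step f′ (into₂ (λ n → proj₁ (f′∈ n))) Z v ∋v unsafe)
        where
        step : ∀ f′ → Branches (proj₁ q₂) f′ → ∀ Z v → Z ∋ v → v ∉ Safe i f′ → ReachStep (Target f′ s) Y w Z
        step f′ f′∈ Z v ∋v unsafe = either (dne λ ¬target → unsafe λ _ target → ¬target target)
          where
          legal : Legal w v
          legal = dne λ ¬legal → unsafe λ legal → contradiction legal ¬legal

          either : Target f′ s (v ∷ w) ⊎ Reaches f′ (v ∷ w) s → ReachStep (Target f′ s) Y w Z
          either (inj₁ target)  = stop v ∋v legal target
          either (inj₂ reaches) = go v ∋v legal (reach-on-Y f′ (v ∷ w) s f′∈ reaches)

      -- Without `Reaches` the settled alternative must be `Inside`, so beyond some number all
      -- vectors of `Y` are safe; the maximum over the nodes of one level serves all branches.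
      safeFrom : ∀ i → ∃[ N ] ∀ f → Branches (proj₁ q₃) f → ¬ Reaches f (proj₁ i) (proj₂ i) →
                 ∀ {v} → Y ∋ v → Above N v → v ∈ Safe i f
      safeFrom i = maxOver (level₃ i) N , λ f f∈ ¬reaches {v} ∋v above →
        let t = applyUpTo f (level₃ i) in
        N-safe t (insideAt f f∈ ¬reaches) ∋v (Above-mono (≤-maxOver N t (length-applyUpTo f (level₃ i))) above)
          f (Branches-cut (proj₁ q₃) f∈ (⊏-applyUpTo f _))
        where
        InsideAt : List Bool → Set
        InsideAt t = ∃[ Y′ ] Y′ ∈ U × Meeting ((true , true) , i , t) Y′

        insideAt : ∀ f → Branches (proj₁ q₃) f → ¬ Reaches f (proj₁ i) (proj₂ i) →
                   InsideAt (applyUpTo f (level₃ i))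
        insideAt f f∈ ¬reaches with settledAt i f f∈
        ... | Y′ , Y′∈U , inj₁ inside   = Y′ , Y′∈U , 0 , λ ∋v _ f′ f′∈ → inside f′ f′∈ ∋v
        ... | Y′ , Y′∈U , inj₂ escaping =
          contradiction (escaping⇒reaches i f f∈ (Y′ , Y′∈U , escaping)) ¬reaches

        choose : ∀ t → ∃[ N ] (InsideAt t → ∀ {v} → Y ∋ v → Above N v →
                              ∀ f → Branches (cut (proj₁ q₃) t) f → v ∈ Safe i f)
        choose t with em {P = InsideAt t}
        ... | yes inside = let N , safe = attain ((true , true) , i , t) inside in N , λ _ → safe
        ... | no outside = 0 , λ inside → contradiction inside outside

        N : List Bool → ℕ
        N t = proj₁ (choose t)

        N-safe = λ t → proj₂ (choose t)

      maxUpTo : ℕ → (ℕ → ℕ) → ℕ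
      maxUpTo zero    g = g 0
      maxUpTo (suc k) g = g (suc k) ⊔ maxUpTo k g

      ≤-maxUpTo : ∀ {n k} g → n ≤ k → g n ≤ maxUpTo k g
      ≤-maxUpTo {zero} {zero} g _ = ≤-refl
      ≤-maxUpTo {n} {suc k} g le with n ≟ suc k
      ... | yes refl = m≤m⊔n _ _
      ... | no n≢    = ≤-trans (≤-maxUpTo g (≤-pred (≤∧≢⇒< le n≢))) (m≤n⊔m (g (suc k)) _)

      module _ (s : List ℕ) where

        joined : List ℕ → List ℕ → ℕ → ℕ
        joined u w n = proj₁ (joinedStrategy (w , n ∷ s)) u

        -- Player I follows at `u` every strategy begun at an initial part `w` of `u` for a digit at
        -- most `length w`; there are finitely many.
        joinedBelow : List ℕ → List ℕ → ℕ
        joinedBelow u []      = maxUpTo 0 (joined u [])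
        joinedBelow u (v ∷ w) = maxUpTo (suc (length w)) (joined u (v ∷ w)) ⊔ joinedBelow u w

        ≤-joinedBelow : ∀ u z {n j k} → n ≤ j → j ≤ k →
                        joined u (applyDownFrom z j) n ≤ joinedBelow u (applyDownFrom z k)
        ≤-joinedBelow u z {n} {j} {k} n≤j j≤k with j ≟ k
        ≤-joinedBelow u z {n} {zero} n≤j j≤k | yes refl = ≤-maxUpTo (joined u []) n≤j
        ≤-joinedBelow u z {n} {suc j} n≤j j≤k | yes refl =
          ≤-trans (≤-maxUpTo (joined u _) (≤-trans n≤j (s≤s (≤-reflexive (sym (length-applyDownFrom z j))))))
                  (m≤m⊔n _ _)
        ≤-joinedBelow u z {k = zero} n≤j z≤n | no j≢k = contradiction refl j≢k
        ≤-joinedBelow u z {k = suc k} n≤j j≤k | no j≢k =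
          ≤-trans (≤-joinedBelow u z n≤j (≤-pred (≤∧≢⇒< j≤k j≢k))) (m≤n⊔m _ (joinedBelow u (applyDownFrom z k)))

        combined : List ℕ → ℕ
        combined u = proj₁ (safeFrom (u , s)) ⊔ joinedBelow u u

        -- Suppose a witness `g` continues `s` by the digit `n`. All moves are safe, so a position
        -- of length at least `n` is not a target and is won by I for `n ∷ s`. From there on
        -- `combined` dominates the corresponding strategy, which excludes `g`.
        combined-avoids : ∀ w f → Branches (proj₁ q₃) f → ¬ Reaches f w s →
                          ∀ z → FOutcome w Y combined z → ¬ Hit s f z
        combined-avoids w f f∈ ¬reaches z (start , play) (g , digits , Cfzg) =
          proj₂ (joinedStrategy (applyDownFrom z j , n ∷ s)) f (into₁ f∈)
            (dne λ ¬won → proj₁ (safe (length w ⊔ n) (m≤m⊔n _ n)) (n , n≤ , ¬won)) z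
            (cong (applyDownFrom z) (length-applyDownFrom z j) , λ k le →
              let j≤k = subst (_≤ k) (length-applyDownFrom z j) le
                  ∋z , legal , above = play k (≤-trans (m≤m⊔n _ n) (≤-trans (n≤1+n _) j≤k))
              in ∋z , legal , Above-mono
                   (≤-trans (≤-joinedBelow (applyDownFrom z k) z (≤-trans (m≤n⊔m (length w) n) (n≤1+n _)) j≤k)
                            (m≤n⊔m (proj₁ (safeFrom (applyDownFrom z k , s))) _))
                   above)
            (g , cong (n ∷_) digits , Cfzg)
          where
          n = g (length s)
          -- Targets are known to be missed only after a move from `w`, whence the successor; `n` is
          -- included to meet the bound on the digit.
          j = suc (length w ⊔ n)

          n≤ : n ≤ length (applyDownFrom z j)
          n≤ = subst (n ≤_) (sym (length-applyDownFrom z j)) (≤-trans (m≤n⊔m (length w) n) (n≤1+n _))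

          safeStep : ∀ k → length w ≤ k → ¬ Reaches f (applyDownFrom z k) s →
                     ¬ Target f s (applyDownFrom z (suc k)) × ¬ Reaches f (applyDownFrom z (suc k)) s
          safeStep k le ¬r =
            let ∋z , legal , above = play k le
                safe = proj₂ (safeFrom (applyDownFrom z k , s)) f f∈ ¬r ∋z (Above-mono (m≤m⊔n _ _) above) legal
            in (λ target → safe (inj₁ target)) , λ reaches → safe (inj₂ reaches)

          stays : ∀ k → length w ≤ k → ¬ Reaches f (applyDownFrom z k) s
          stays k le with length w ≟ k
          ... | yes refl = subst (λ u → ¬ Reaches f u s) (sym start) ¬reaches
          stays zero le | no neq = contradiction (n≤0⇒n≡0 le) neq
          stays (suc k) le | no neq = let le′ = ≤-pred (≤∧≢⇒< le neq) in proj₂ (safeStep k le′ (stays k le′))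

          safe : ∀ k → length w ≤ k →
                 ¬ Target f s (applyDownFrom z (suc k)) × ¬ Reaches f (applyDownFrom z (suc k)) s
          safe k le = safeStep k le (stays k le)

      -- Failure of `Reaches` at `f` extends to all branches of `q₃` agreeing with `f` up to `m`. As
      -- `combined s` does not depend on the branch, it avoids witnesses of `s` along all of them.
      ¬reaches⇒won : ∀ f w s → Branches (proj₁ q₃) f → ¬ Reaches f w s → WonByI f w s
      ¬reaches⇒won f w s f∈ ¬reaches =
        D₁.level (w , s) , D₁.eventual-refine q₃ (λ x → D₂.q≤p (q₃≤q₂ x)) (w , s) f∈ m
          (Y , Y∈U , combined s , λ f′ f′∈ →
            let f′∈q₃ = λ n → proj₁ (f′∈ n)
                same = subst (λ k → applyUpTo f′ k ≡ applyUpTo f m) (length-applyUpTo f m)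
                         (Branches-cut-⊏ (proj₁ q₃) f′∈)
            in combined-avoids s w f′ f′∈q₃ (D₂.¬eventual-local (w , s) {f} {f′} (into₂ f′∈q₃) same ¬reaches))
        where m = D₂.level (w , s)

      module _ (f : Cantor) (f∈ : Branches (proj₁ q₃) f) (¬won₀ : ¬ WonByI f w₀ []) where

        reaching : ∀ {w s} → ¬ WonByI f w s → Reach (Target f s) Y w
        reaching {w} {s} ¬won = reach-on-Y f w s (into₂ f∈)
          (dne λ ¬reaches → ¬won (¬reaches⇒won f w s f∈ ¬reaches))

        -- The plan is the remainder of a `Reach`. Arrival at a target adds a digit and brings a new
        -- plan, since the new position and digits are again not won by I.
        record Stateᴵᴵ : Set where
          constructor ⟪_,_,_⟫
          field
            pos    : List ℕ
            digits : List ℕ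
            plan   : Reach (Target f digits) Y pos

        open Stateᴵᴵ

        Reply : Stateᴵᴵ → Sub → Set
        Reply S Z = ∃[ v ] Z ∋ v × Legal (pos S) v × (∃[ S′ ] pos S′ ≡ v ∷ pos S)

        answer : ∀ {w s Z} (r : Reach (Target f s) Y w) →
                 ReachStep (Target f s) Y w Z → Reply ⟪ w , s , r ⟫ Z
        answer {w} {s} r (stop v ∋v legal (n , _ , ¬won)) =
          v , ∋v , legal , ⟪ v ∷ w , n ∷ s , reaching ¬won ⟫ , refl
        answer {w} {s} r (go v ∋v legal r′) = v , ∋v , legal , ⟪ v ∷ w , s , r′ ⟫ , refl

        nextᴵᴵ : ∀ S Z → Z ≼ Y → Reply S Z
        nextᴵᴵ ⟪ w , s , r@(reach step) ⟫ Z Z≼Y = answer r (step Z Z≼Y)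

        afterᴵᴵ : ∀ S Z → Z ≼ Y → Stateᴵᴵ
        afterᴵᴵ S Z Z≼Y = proj₁ (proj₂ (proj₂ (proj₂ (nextᴵᴵ S Z Z≼Y))))

        module _ (st : ℕ → Stateᴵᴵ)
          (run : ∀ k → ∃[ Z ] Σ[ Z≼Y ∈ Z ≼ Y ] st (suc k) ≡ afterᴵᴵ (st k) Z Z≼Y) where

          Progress : ℕ → List ℕ → Set
          Progress k s = ∃[ k′ ] ∃[ n ] k < k′ × digits (st k′) ≡ n ∷ s × ¬ WonByI f (pos (st k′)) (n ∷ s)

          mutual
            -- Each move either arrives at a target or passes to a structurally smaller plan, so
            -- another digit appears after finitely many moves.
            progress : ∀ k {w s} (r : Reach (Target f s) Y w) → st k ≡ ⟪ w , s , r ⟫ → Progress k s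
            progress k (reach step) eq =
              let Z , Z≼Y , eq′ = run k
              in progressStep k {r = reach step} (step Z Z≼Y)
                   (trans eq′ (cong (λ S → afterᴵᴵ S Z Z≼Y) eq))

            progressStep : ∀ k {w s Z r} (x : ReachStep (Target f s) Y w Z) →
              st (suc k) ≡ proj₁ (proj₂ (proj₂ (proj₂ (answer r x)))) → Progress k s
            progressStep k {s = s} (stop v ∋v legal (n , _ , ¬won)) eq =
              suc k , n , ≤-refl , cong digits eq ,
              subst (λ S → ¬ WonByI f (pos S) (n ∷ s)) (sym eq) ¬won
            progressStep k (go v ∋v legal r) eq =
              let k′ , n , k<k′ , rest = progress (suc k) r eq in k′ , n , <-trans (n<1+n k) k<k′ , rest

          advance : ∀ k → Progress k (digits (st k))
          advance k = progress k (plan (st k)) refl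

          time : ℕ → ℕ
          time zero    = 0
          time (suc j) = proj₁ (advance (time j))

          digit : ℕ → ℕ
          digit j = proj₁ (proj₂ (advance (time j)))

          ≤-time : ∀ j → j ≤ time j
          ≤-time zero    = z≤n
          ≤-time (suc j) = ≤-trans (s≤s (≤-time j)) (proj₁ (proj₂ (proj₂ (advance (time j)))))

          digits-time : digits (st 0) ≡ [] → ∀ j → digits (st (time j)) ≡ applyDownFrom digit j
          digits-time eq zero    = eq
          digits-time eq (suc j) = trans (proj₁ (proj₂ (proj₂ (proj₂ (advance (time j))))))
                                         (cong (digit j ∷_) (digits-time eq j))

          ¬won-time : pos (st 0) ≡ w₀ → digits (st 0) ≡ [] →
                      ∀ j → ¬ WonByI f (pos (st (time j))) (digits (st (time j)))
          ¬won-time pos₀ digits₀ zero =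
            subst₂ (λ w s → ¬ WonByI f w s) (sym pos₀) (sym digits₀) ¬won₀
          ¬won-time pos₀ digits₀ (suc j) =
            let _ , _ , _ , eq , ¬won = advance (time j)
            in subst (λ s → ¬ WonByI f (pos (st (time (suc j)))) s) (sym eq) ¬won

        start : Stateᴵᴵ
        start = ⟪ w₀ , [] , reaching ¬won₀ ⟫

        -- At infinitely many times the position and the digits found so far are not won by I, so
        -- some element of `C` agrees with them and with `f` as far as desired; `C` being closed,
        -- the limit belongs to it.
        winsᴵᴵ : ∀ (st : ℕ → Stateᴵᴵ) z → st 0 ≡ start →
             (∀ k → ∃[ Z ] Σ[ Z≼Y ∈ Z ≼ Y ] st (suc k) ≡ afterᴵᴵ (st k) Z Z≼Y) →
             (∀ k → applyDownFrom z (length w₀ + k) ≡ pos (st k)) →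
             (∀ k → length w₀ ≤ k → Legal (applyDownFrom z k) (z k)) → ∃[ g ] C f z g
        winsᴵᴵ st z st₀ run positions legal = g , C-closed f z g legal
          (trans (cong (applyDownFrom z) (sym (+-identityʳ _))) (trans (positions 0) (cong pos st₀))) approx
          where
          g = digit st run

          approx : ∀ n → ∃[ f′ ] ∃[ z′ ] ∃[ g′ ] C f′ z′ g′ ×
                         (∀ k → k < n → f k ≡ f′ k × z k ≡ z′ k × g k ≡ g′ k)
          approx n = f′ , z′ , g′ , Cfzg , λ k k<n →
            applyUpTo-≡ same-f k<n ,
            applyDownFrom-≡ same-z (≤-trans k<n (≤-trans (≤-time st run n) (m≤n+m _ (length w₀)))) ,
            applyDownFrom-≡ same-g k<n
            where
            S = st (time st run n)

            Near : Set
            Near = ∃[ f′ ] ∃[ z′ ] Branches (cut (proj₁ q₁) (applyUpTo f n)) f′ ×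
                   applyDownFrom z′ (length (pos S)) ≡ pos S × Hit (digits S) f′ z′

            near : Near
            -- Without such an element, player I would win by always playing 0.
            near = dne λ none → ¬won-time st run (cong pos st₀) (cong digits st₀) n
              (n , Y , Y∈U , (λ _ → 0) , λ f′ f′∈ z′ (eq , _) hit → none (f′ , z′ , f′∈ , eq , hit))

            f′ = proj₁ near
            z′ = proj₁ (proj₂ near)
            g′ = proj₁ (proj₂ (proj₂ (proj₂ (proj₂ near))))
            Cfzg = proj₂ (proj₂ (proj₂ (proj₂ (proj₂ (proj₂ near)))))

            same-f : applyUpTo f n ≡ applyUpTo f′ n
            same-f = sym (subst (λ k → applyUpTo f′ k ≡ applyUpTo f n) (length-applyUpTo f n)
                       (Branches-cut-⊏ (proj₁ q₁) (proj₁ (proj₂ (proj₂ near)))))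

            len : length (pos S) ≡ length w₀ + time st run n
            len = trans (cong length (sym (positions (time st run n)))) (length-applyDownFrom z _)

            same-z : applyDownFrom z (length w₀ + time st run n) ≡ applyDownFrom z′ (length w₀ + time st run n)
            same-z = trans (positions (time st run n))
              (trans (sym (proj₁ (proj₂ (proj₂ (proj₂ near))))) (cong (applyDownFrom z′) len))

            ds : digits S ≡ applyDownFrom g n
            ds = digits-time st run (cong digits st₀) n

            same-g : applyDownFrom g n ≡ applyDownFrom g′ n
            same-g = trans (sym ds) (trans (sym (proj₁ (proj₂ (proj₂ (proj₂ (proj₂ (proj₂ near)))))))
              (cong (applyDownFrom g′) (trans (cong length ds) (length-applyDownFrom g n))))

        winning : WinningII w₀ Y (λ z → ∃[ g ] C f z g)
        winning = record
          { State = Stateᴵᴵ ; initial = start ; position = pos ; next = nextᴵᴵ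
          ; position-initial = refl ; wins = winsᴵᴵ }

    abstract
      -- A branch on which I wins from the start yields (i) on the cut of `q₃` at one of its nodes.
      -- If there is none, each branch has its own strategy for II.
      parametrizedRamsey : ∃[ Y ] Y ∈ U × Y ≼ X × Σ[ q ∈ PerfectTree ] q ≤ᵀ p ×
        ((∃[ σ ] ∀ f → Branches (proj₁ q) f → ∀ z → FOutcome w₀ Y σ z → ¬ (∃[ g ] C f z g)) ⊎
         (∀ f → Branches (proj₁ q) f → WinningII w₀ Y (λ z → ∃[ g ] C f z g)))
      parametrizedRamsey with em {P = ∃[ f ] Branches (proj₁ q₃) f × WonByI f w₀ []}
      ... | yes (f , f∈ , n , avoidable) =
        let σ , avoids = attain ((false , false) , (w₀ , []) , applyUpTo f n) avoidable
        in Y , Y∈U , proj₁ (proj₂ (proj₂ uniform)) ,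
           cutᵀ q₃ (applyUpTo f n) (f∈ n) , (λ x → D₁.q≤p (D₂.q≤p (q₃≤q₂ (proj₁ x)))) ,
           inj₁ (σ , λ f′ f′∈ z out (g , Cfzg) →
             avoids f′ (λ k → cut-mono {proj₁ q₁} (λ x → D₂.q≤p (q₃≤q₂ x)) (f′∈ k)) z out (g , refl , Cfzg))
      ... | no none =
        Y , Y∈U , proj₁ (proj₂ (proj₂ uniform)) , q₃ , (λ x → D₁.q≤p (D₂.q≤p (q₃≤q₂ x))) ,
        inj₂ λ f f∈ → winning f f∈ λ won → none (f , f∈ , won)

-- Vector spaces with a countable basis

module Coordinates (em : ∀ {ℓ} → ExcludedMiddle ℓ) {F : CommutativeRing 0ℓ 0ℓ} (E : Module F 0ℓ 0ℓ)
  (e : ℕ → Module.Carrierᴹ E) (basis : IsBasis E e) where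

  open Classical em
  private module 𝔽 = CommutativeRing F
  open 𝔽 using (_≈_; _≉_; 0#; 1#) renaming (Carrier to Scalar; _+_ to _+ˢ_; _*_ to _*ˢ_; -_ to -ˢ_)
  open Module E
  open Span E hiding (IsBasis)
  open Blocks E e
  open IsBasis basis
  open import Algebra.Properties.Group +ᴹ-group using (identityˡ-unique)
  open import Algebra.Properties.CommutativeSemigroup
    (CommutativeMonoid.commutativeSemigroup +ᴹ-commutativeMonoid)
    using (interchange)
  open import Data.Vec.Functional using (Vector)
  import Relation.Binary.Reasoning.Setoid ≈ᴹ-setoid as ≈ᴹ-Reasoning

  combination : (ℕ → Carrierᴹ) → (ℕ → Scalar) → ℕ → Carrierᴹ
  combination x a n = lin x {n} (λ i → a (toℕ i))

  extend : ∀ {n} → Vector Scalar n → ℕ → Scalar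
  extend {zero}  c k       = 0#
  extend {suc n} c zero    = c Fin.zero
  extend {suc n} c (suc k) = extend (c ∘ Fin.suc) k

  extend-toℕ : ∀ {n} (c : Vector Scalar n) i → extend c (toℕ i) ≡ c i
  extend-toℕ c Fin.zero    = refl
  extend-toℕ c (Fin.suc i) = extend-toℕ (c ∘ Fin.suc) i

  extend-≥ : ∀ {n} (c : Vector Scalar n) {k} → n ≤ k → extend c k ≈ 0#
  extend-≥ {zero}  c _        = 𝔽.refl
  extend-≥ {suc n} c (s≤s le) = extend-≥ (c ∘ Fin.suc) le

  combination-extend : ∀ {n} x (c : Vector Scalar n) → lin x c ≈ᴹ combination x (extend c) n
  combination-extend {zero}  x c = ≈ᴹ-refl
  combination-extend {suc n} x c = +ᴹ-cong ≈ᴹ-refl (combination-extend (x ∘ suc) (c ∘ Fin.suc))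

  combination-zero : ∀ x a n → (∀ k → k < n → a k ≈ 0#) → combination x a n ≈ᴹ 0ᴹ
  combination-zero x a zero    _    = ≈ᴹ-refl
  combination-zero x a (suc n) zero≈ = begin
    a 0 *ₗ x 0 +ᴹ combination (x ∘ suc) (a ∘ suc) n
      ≈⟨ +ᴹ-cong (≈ᴹ-trans (*ₗ-cong (zero≈ 0 (s≤s z≤n)) ≈ᴹ-refl) (*ₗ-zeroˡ _))
                 (combination-zero (x ∘ suc) (a ∘ suc) n (λ k lt → zero≈ (suc k) (s≤s lt))) ⟩
    0ᴹ +ᴹ 0ᴹ  ≈⟨ +ᴹ-identityˡ 0ᴹ ⟩
    0ᴹ        ∎
    where open ≈ᴹ-Reasoning

  combination-cong : ∀ {x y a b} n → (∀ k → x k ≈ᴹ y k) → (∀ k → a k ≈ b k) →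
                     combination x a n ≈ᴹ combination y b n
  combination-cong zero    _ _ = ≈ᴹ-refl
  combination-cong (suc n) x≈y a≈b =
    +ᴹ-cong (*ₗ-cong (a≈b 0) (x≈y 0)) (combination-cong n (x≈y ∘ suc) (a≈b ∘ suc))

  combination-+ : ∀ x a b n →
    combination x (λ k → a k +ˢ b k) n ≈ᴹ combination x a n +ᴹ combination x b n
  combination-+ x a b zero    = ≈ᴹ-sym (+ᴹ-identityˡ 0ᴹ)
  combination-+ x a b (suc n) =
    ≈ᴹ-trans (+ᴹ-cong (*ₗ-distribʳ _ _ _) (combination-+ (x ∘ suc) (a ∘ suc) (b ∘ suc) n))
             (interchange _ _ _ _)

  combination-* : ∀ x s a n → combination x (λ k → s *ˢ a k) n ≈ᴹ s *ₗ combination x a n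
  combination-* x s a zero    = ≈ᴹ-sym (*ₗ-zeroʳ s)
  combination-* x s a (suc n) =
    ≈ᴹ-trans (+ᴹ-cong (*ₗ-assoc _ _ _) (combination-* (x ∘ suc) s (a ∘ suc) n)) (≈ᴹ-sym (*ₗ-distribˡ _ _ _))

  combination-split : ∀ x a m n → combination x a (m + n) ≈ᴹ
    combination x a m +ᴹ combination (λ k → x (m + k)) (λ k → a (m + k)) n
  combination-split x a zero    n = ≈ᴹ-sym (+ᴹ-identityˡ _)
  combination-split x a (suc m) n =
    ≈ᴹ-trans (+ᴹ-cong ≈ᴹ-refl (combination-split (x ∘ suc) (a ∘ suc) m n)) (≈ᴹ-sym (+ᴹ-assoc _ _ _))

  combination-pad : ∀ x a {n N} → n ≤ N → (∀ k → n ≤ k → a k ≈ 0#) →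
                    combination x a N ≈ᴹ combination x a n
  combination-pad x a {n} {N} n≤N zero≈ = begin
    combination x a N                            ≡⟨ cong (combination x a) (m+[n∸m]≡n n≤N) ⟨
    combination x a (n + (N ∸ n))                ≈⟨ combination-split x a n (N ∸ n) ⟩
    combination x a n +ᴹ combination x′ a′ (N ∸ n)
      ≈⟨ +ᴹ-cong ≈ᴹ-refl (combination-zero x′ a′ (N ∸ n) (λ k _ → zero≈ (n + k) (m≤m+n n k))) ⟩
    combination x a n +ᴹ 0ᴹ                      ≈⟨ +ᴹ-identityʳ _ ⟩
    combination x a n                            ∎
    where
    open ≈ᴹ-Reasoning
    x′ : ℕ → Carrierᴹ
    x′ k = x (n + k)
    a′ : ℕ → Scalar
    a′ k = a (n + k)

  size : Carrierᴹ → ℕ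
  size v = proj₁ (spans v)

  coord : Carrierᴹ → ℕ → Scalar
  coord v = extend (proj₁ (proj₂ (spans v)))

  coord-≥ : ∀ v {k} → size v ≤ k → coord v k ≈ 0#
  coord-≥ v = extend-≥ (proj₁ (proj₂ (spans v)))

  expansion : ∀ v → v ≈ᴹ combination e (coord v) (size v)
  expansion v = ≈ᴹ-trans (proj₂ (proj₂ (spans v))) (combination-extend e (proj₁ (proj₂ (spans v))))

  -- Independence is applied to the difference of the two coefficient sequences, both cut at a
  -- length beyond which they vanish.
  coord-unique : ∀ {v a N} → (∀ k → N ≤ k → a k ≈ 0#) → v ≈ᴹ combination e a N → ∀ k → coord v k ≈ a k
  coord-unique {v} {a} {N} zero≈ v≈ k with k <? size v + N
  ... | no k≮ = 𝔽.trans (coord-≥ v (≤-trans (m≤m+n _ N) (≮⇒≥ k≮)))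
                        (𝔽.sym (zero≈ k (≤-trans (m≤n+m N _) (≮⇒≥ k≮))))
  ... | yes k< = 𝔽.trans (𝔽.sym (d+a≈coord k)) (𝔽.trans (𝔽.+-congʳ difference) (𝔽.+-identityˡ _))
    where
    open import Data.Fin.Base using (fromℕ<)
    open import Data.Fin.Properties using (toℕ-fromℕ<)

    M = size v + N
    d : ℕ → Scalar
    d k = coord v k +ˢ -ˢ a k

    d+a≈coord : ∀ k → d k +ˢ a k ≈ coord v k
    d+a≈coord k = 𝔽.trans (𝔽.+-assoc _ _ _) (𝔽.trans (𝔽.+-congˡ (𝔽.-‿inverseˡ (a k))) (𝔽.+-identityʳ _))

    vanishes : combination e d M ≈ᴹ 0ᴹ
    vanishes = identityˡ-unique (combination e d M) (combination e a M) (begin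
      combination e d M +ᴹ combination e a M  ≈⟨ combination-+ e d a M ⟨
      combination e (λ k → d k +ˢ a k) M      ≈⟨ combination-cong {e} {e} M (λ _ → ≈ᴹ-refl) d+a≈coord ⟩
      combination e (coord v) M               ≈⟨ combination-pad e (coord v) (m≤m+n _ N) (λ k → coord-≥ v) ⟩
      combination e (coord v) (size v)        ≈⟨ expansion v ⟨
      v                                       ≈⟨ v≈ ⟩
      combination e a N                       ≈⟨ combination-pad e a {N} {M} (m≤n+m N _) zero≈ ⟨
      combination e a M                       ∎)
      where open ≈ᴹ-Reasoning

    difference : d k ≈ 0#
    difference = 𝔽.trans (𝔽.reflexive (cong d (sym (toℕ-fromℕ< k<))))
                         (independent (λ i → d (toℕ i)) vanishes (fromℕ< k<))

  coord-cong : ∀ {u v} → u ≈ᴹ v → ∀ k → coord u k ≈ coord v k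
  coord-cong {u} {v} u≈v = coord-unique (λ k → coord-≥ v) (≈ᴹ-trans u≈v (expansion v))

  coord-0 : ∀ k → coord 0ᴹ k ≈ 0#
  coord-0 = coord-unique {N = 0} (λ _ _ → 𝔽.refl) ≈ᴹ-refl

  coord-+ : ∀ u v k → coord (u +ᴹ v) k ≈ coord u k +ˢ coord v k
  coord-+ u v = coord-unique {N = size u + size v}
    (λ k le → 𝔽.trans (𝔽.+-cong (coord-≥ u (≤-trans (m≤m+n _ _) le))
                                (coord-≥ v (≤-trans (m≤n+m _ (size u)) le)))
                      (𝔽.+-identityˡ 0#))
    (begin
      u +ᴹ v
        ≈⟨ +ᴹ-cong (expansion u) (expansion v) ⟩
      combination e (coord u) (size u) +ᴹ combination e (coord v) (size v)
        ≈⟨ +ᴹ-cong (combination-pad e (coord u) (m≤m+n _ _) (λ k → coord-≥ u))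
                   (combination-pad e (coord v) (m≤n+m _ (size u)) (λ k → coord-≥ v)) ⟨
      combination e (coord u) (size u + size v) +ᴹ combination e (coord v) (size u + size v)
        ≈⟨ combination-+ e (coord u) (coord v) (size u + size v) ⟨
      combination e (λ k → coord u k +ˢ coord v k) (size u + size v) ∎)
    where open ≈ᴹ-Reasoning

  coord-* : ∀ s v k → coord (s *ₗ v) k ≈ s *ˢ coord v k
  coord-* s v = coord-unique {N = size v}
    (λ k le → 𝔽.trans (𝔽.*-congˡ (coord-≥ v le)) (𝔽.zeroʳ s))
    (≈ᴹ-trans (*ₗ-cong 𝔽.refl (expansion v)) (≈ᴹ-sym (combination-* e s (coord v) (size v))))

  coord-combination-zero : ∀ x a n j → (∀ k → k < n → coord (x k) j ≈ 0#) → coord (combination x a n) j ≈ 0#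
  coord-combination-zero x a zero    j _     = coord-0 j
  coord-combination-zero x a (suc n) j zero≈ =
    𝔽.trans (coord-+ _ _ j) (𝔽.trans (𝔽.+-cong
      (𝔽.trans (coord-* (a 0) (x 0) j) (𝔽.trans (𝔽.*-congˡ (zero≈ 0 (s≤s z≤n))) (𝔽.zeroʳ (a 0))))
      (coord-combination-zero (x ∘ suc) (a ∘ suc) n j (λ k lt → zero≈ (suc k) (s≤s lt))))
      (𝔽.+-identityˡ 0#))

  supp⇒coord : ∀ {k v} → k ∈supp v → coord v k ≉ 0#
  supp⇒coord (n , c , v≈ , i , refl , ci≉0) coord≈0 = ci≉0 (𝔽.trans (𝔽.sym (𝔽.trans
    (coord-unique (λ k → extend-≥ c) (≈ᴹ-trans v≈ (combination-extend e c)) (toℕ i))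
    (𝔽.reflexive (extend-toℕ c i)))) coord≈0)

  coord⇒supp : ∀ {k v} → coord v k ≉ 0# → k ∈supp v
  coord⇒supp {k} {v} coord≉0 =
    size v , proj₁ (proj₂ (spans v)) , proj₂ (proj₂ (spans v)) , fromℕ< k< , toℕ-fromℕ< k< ,
    λ c≈0 → coord≉0 (𝔽.trans (𝔽.reflexive (trans (cong (coord v) (sym (toℕ-fromℕ< k<)))
                                                 (extend-toℕ _ (fromℕ< k<)))) c≈0)
    where
    open import Data.Fin.Base using (fromℕ<)
    open import Data.Fin.Properties using (toℕ-fromℕ<)
    k< : k < size v
    k< = ≰⇒> λ le → coord≉0 (coord-≥ v le)

  supp-resp : ∀ {k u v} → u ≈ᴹ v → k ∈supp u → k ∈supp v
  supp-resp u≈v (n , c , u≈ , rest) = n , c , ≈ᴹ-trans (≈ᴹ-sym u≈v) u≈ , rest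

  ≪-resp : ∀ {u u′ v v′} → u ≈ᴹ u′ → v ≈ᴹ v′ → u ≪ v → u′ ≪ v′
  ≪-resp u≈ v≈ u≪v i∈ j∈ = u≪v (supp-resp (≈ᴹ-sym u≈) i∈) (supp-resp (≈ᴹ-sym v≈) j∈)

  supp-< : ∀ {k v} → k ∈supp v → k < size v
  supp-< {v = v} k∈ = ≰⇒> λ le → supp⇒coord k∈ (coord-≥ v le)

  supp-nonempty : ∀ {v} → ¬ v ≈ᴹ 0ᴹ → ∃[ k ] k ∈supp v
  supp-nonempty {v} v≉0 = dne λ none → v≉0 (≈ᴹ-trans (expansion v)
    (combination-zero e (coord v) (size v) λ k _ → dne λ coord≉0 → none (k , coord⇒supp coord≉0)))

  supp-lin : ∀ {j v} x → v ∈ ⟨ x ⟩ → j ∈supp v → ∃[ i ] j ∈supp x i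
  supp-lin {j} {v} x (n , c , v≈) j∈ = dne λ none → supp⇒coord j∈
    (𝔽.trans (coord-cong (≈ᴹ-trans v≈ (combination-extend x c)) j)
      (coord-combination-zero x (extend c) n j λ k _ → dne λ coord≉0 → none (k , coord⇒supp coord≉0)))

  span-resp : ∀ x {u v} → u ≈ᴹ v → u ∈ ⟨ x ⟩ → v ∈ ⟨ x ⟩
  span-resp x u≈v (n , c , u≈) = n , c , ≈ᴹ-trans (≈ᴹ-sym u≈v) u≈

  span-0 : ∀ x → 0ᴹ ∈ ⟨ x ⟩
  span-0 x = 0 , (λ ()) , ≈ᴹ-refl

  span-+ : ∀ x {u v} → u ∈ ⟨ x ⟩ → v ∈ ⟨ x ⟩ → (u +ᴹ v) ∈ ⟨ x ⟩
  span-+ x {u} {v} (m , c , u≈) (n , d , v≈) =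
    m + n , (λ i → extend c (toℕ i) +ˢ extend d (toℕ i)) , (begin
      u +ᴹ v
        ≈⟨ +ᴹ-cong (≈ᴹ-trans u≈ (combination-extend x c)) (≈ᴹ-trans v≈ (combination-extend x d)) ⟩
      combination x (extend c) m +ᴹ combination x (extend d) n
        ≈⟨ +ᴹ-cong (combination-pad x (extend c) (m≤m+n m n) (λ k → extend-≥ c))
                   (combination-pad x (extend d) (m≤n+m n m) (λ k → extend-≥ d)) ⟨
      combination x (extend c) (m + n) +ᴹ combination x (extend d) (m + n)
        ≈⟨ combination-+ x (extend c) (extend d) (m + n) ⟨
      combination x (λ k → extend c k +ˢ extend d k) (m + n) ∎)
    where open ≈ᴹ-Reasoning

  span-* : ∀ x {v} s → v ∈ ⟨ x ⟩ → (s *ₗ v) ∈ ⟨ x ⟩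
  span-* x {v} s (n , c , v≈) = n , (λ i → s *ˢ extend c (toℕ i)) ,
    ≈ᴹ-trans (*ₗ-cong 𝔽.refl (≈ᴹ-trans v≈ (combination-extend x c)))
             (≈ᴹ-sym (combination-* x s (extend c) n))

  span-lin : ∀ x {y : ℕ → Carrierᴹ} → (∀ i → y i ∈ ⟨ x ⟩) → ⟨ y ⟩ ⊆ ⟨ x ⟩
  span-lin x {y} y∈ (n , c , v≈) = span-resp x (≈ᴹ-sym v≈) (go n y y∈ c)
    where
    go : ∀ n (y : ℕ → Carrierᴹ) → (∀ i → y i ∈ ⟨ x ⟩) → (c : Vector Scalar n) → lin y c ∈ ⟨ x ⟩
    go zero    y y∈ c = span-0 x
    go (suc n) y y∈ c = span-+ x (span-* x (c Fin.zero) (y∈ 0)) (go n (y ∘ suc) (y∈ ∘ suc) (c ∘ Fin.suc))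

  span-generator : ∀ (x : ℕ → Carrierᴹ) i → x i ∈ ⟨ x ⟩
  span-generator x i = suc i , (λ k → δ i (toℕ k)) , ≈ᴹ-sym (lemma x i)
    where
    δ : ℕ → ℕ → Scalar
    δ zero    zero    = 1#
    δ zero    (suc k) = 0#
    δ (suc i) zero    = 0#
    δ (suc i) (suc k) = δ i k

    lemma : ∀ x i → combination x (δ i) (suc i) ≈ᴹ x i
    lemma x zero    = ≈ᴹ-trans (+ᴹ-identityʳ _) (*ₗ-identityˡ _)
    lemma x (suc i) = ≈ᴹ-trans (+ᴹ-cong (*ₗ-zeroˡ _) (lemma (x ∘ suc) i)) (+ᴹ-identityˡ _)

  block-nonempty : ∀ (Y : BlockSeq) n → ∃[ k ] k ∈supp proj₁ Y n
  block-nonempty (y , nonzero , _) n = supp-nonempty (nonzero n)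

  -- Transitivity of `≪` goes through an index in the support of the middle vector, which exists
  -- because blocks are nonzero.
  block-≪ : ∀ (Y : BlockSeq) {m n} → m < n → proj₁ Y m ≪ proj₁ Y n
  block-≪ Y@(y , _ , succ) {m} {suc n} (s≤s m≤n) with m ≟ n
  ... | yes refl = succ n
  ... | no m≢n   = λ i∈ j∈ → let k , k∈ = block-nonempty Y n
                             in <-trans (block-≪ Y (≤∧≢⇒< m≤n m≢n) i∈ k∈) (succ n k∈ j∈)

  block-≥ : ∀ (Y : BlockSeq) n {j} → j ∈supp proj₁ Y n → n ≤ j
  block-≥ Y zero    j∈ = z≤n
  block-≥ Y (suc n) j∈ = let k , k∈ = block-nonempty Y n
                         in ≤-trans (s≤s (block-≥ Y n k∈)) (proj₂ (proj₂ Y) n k∈ j∈)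

  -- Block `n` is supported at or above `n`, so dropping `suc N` blocks leaves supports strictly
  -- above `N`.
  tailSeq : BlockSeq → ℕ → BlockSeq
  tailSeq (z , nonzero , succ) N = (λ n → z (suc N + n)) , (λ n → nonzero (suc N + n)) ,
    λ n → subst (λ k → z (suc N + n) ≪ z k) (sym (+-suc (suc N) n)) (succ (suc N + n))

  tailSeq-⊆ : ∀ Z N → ⟨ proj₁ (tailSeq Z N) ⟩ ⊆ ⟨ proj₁ Z ⟩
  tailSeq-⊆ Z N = span-lin (proj₁ Z) λ i → span-generator (proj₁ Z) (suc N + i)

  tailSeq-above : ∀ Z N {v} → v ∈ ⟨ proj₁ (tailSeq Z N) ⟩ → N <supp v
  tailSeq-above Z N v∈ j∈ = let i , j∈i = supp-lin (proj₁ (tailSeq Z N)) v∈ j∈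
                            in ≤-trans (s≤s (m≤m+n N i)) (block-≥ Z (suc N + i) j∈i)

  bound : (ℕ → Carrierᴹ) → ℕ → ℕ
  bound y zero    = 0
  bound y (suc m) = size (y m) ⊔ bound y m

  ≤-bound : ∀ y {i m} → i < m → size (y i) ≤ bound y m
  ≤-bound y {i} {suc m} (s≤s i≤m) with i ≟ m
  ... | yes refl = m≤m⊔n _ _
  ... | no i≢m   = ≤-trans (≤-bound y (≤∧≢⇒< i≤m i≢m)) (m≤n⊔m (size (y m)) _)

  -- Of the expansion of v in the block sequence Y, the part u over the first m
  -- terms has no support: it would be support of v, as blocks are disjoint.
  drop-initial : ∀ (Y : BlockSeq) m {v} → v ∈ ⟨ proj₁ Y ⟩ → bound (proj₁ Y) m <supp v →
                 v ∈ ⟨ (λ n → proj₁ Y (m + n)) ⟩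
  drop-initial Y@(y , _) m {v} (n , c , v≈) above =
    n , (λ i → extend c (m + toℕ i)) , (begin
      v        ≈⟨ v≈u+t ⟩
      u +ᴹ t   ≈⟨ +ᴹ-cong u≈0 ≈ᴹ-refl ⟩
      0ᴹ +ᴹ t  ≈⟨ +ᴹ-identityˡ t ⟩
      t        ∎)
    where
    open ≈ᴹ-Reasoning
    u = combination y (extend c) m
    t = combination (λ k → y (m + k)) (λ k → extend c (m + k)) n

    v≈u+t : v ≈ᴹ u +ᴹ t
    v≈u+t = ≈ᴹ-trans v≈ (≈ᴹ-trans (combination-extend y c)
      (≈ᴹ-trans (≈ᴹ-sym (combination-pad y (extend c) (m≤n+m n m) (λ k → extend-≥ c)))
                (combination-split y (extend c) m n)))

    u-supp : ∀ {j} → j ∈supp u → ∃[ i ] i < m × j ∈supp y i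
    u-supp {j} j∈ = dne λ none → supp⇒coord j∈ (coord-combination-zero y (extend c) m j
      λ k k<m → dne λ coord≉0 → none (k , k<m , coord⇒supp coord≉0))

    t-zero : ∀ {i j} → i < m → j ∈supp y i → coord t j ≈ 0#
    t-zero {i} {j} i<m j∈ = coord-combination-zero (λ k → y (m + k)) (λ k → extend c (m + k)) n j λ k _ →
      dne λ coord≉0 → <-irrefl refl (block-≪ Y (≤-trans i<m (m≤m+n m k)) j∈ (coord⇒supp coord≉0))

    u≈0 : u ≈ᴹ 0ᴹ
    u≈0 = dne λ u≉0 →
      let j , j∈ = supp-nonempty u≉0
          i , i<m , j∈i = u-supp j∈
          coord≈ : coord v j ≈ coord u j
          coord≈ = 𝔽.trans (coord-cong v≈u+t j) (𝔽.trans (coord-+ u t j)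
                     (𝔽.trans (𝔽.+-congˡ (t-zero i<m j∈i)) (𝔽.+-identityʳ _)))
          j∈v : j ∈supp v
          j∈v = coord⇒supp λ z → supp⇒coord j∈ (𝔽.trans (𝔽.sym coord≈) z)
      in <-irrefl refl (<-trans (≤-trans (supp-< j∈i) (≤-bound y i<m)) (above j∈v))

  -- Coding vectors and games by natural numbers

  module Coded (U : Pred BlockSeq 0ℓ) (pfilter : IsP⁺Filter U) (strategicU : IsStrategic U)
    (countable : IsCountable F) where

    private
      scalar : ℕ → Scalar
      scalar = proj₁ countable

      listed : List ℕ → (ℕ → Carrierᴹ) → Carrierᴹ
      listed []       x = 0ᴹ
      listed (k ∷ ks) x = scalar k *ₗ x 0 +ᴹ listed ks (x ∘ suc)

      listed-surjective : ∀ {n} x (c : Vector Scalar n) → ∃[ ks ] listed ks x ≈ᴹ lin x c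
      listed-surjective {zero}  x c = [] , ≈ᴹ-refl
      listed-surjective {suc n} x c =
        let k , scalar≈ = proj₂ countable (c Fin.zero)
            ks , eq = listed-surjective (x ∘ suc) (c ∘ Fin.suc)
        in k ∷ ks , +ᴹ-cong (*ₗ-cong (scalar≈ refl) ≈ᴹ-refl) eq

    abstract
      vec : ℕ → Carrierᴹ
      vec n = listed (proj₁ (enum-List enum-ℕ) n) e

      encode : ∀ v → ∃[ n ] vec n ≈ᴹ v
      encode v =
        let ks , eq = listed-surjective e (proj₁ (proj₂ (spans v)))
            n , eqₙ = proj₂ (enum-List enum-ℕ) ks
        in n , ≈ᴹ-trans (≈ᴹ-reflexive (cong (λ ks → listed ks e) eqₙ))
                        (≈ᴹ-trans eq (≈ᴹ-sym (proj₂ (proj₂ (spans v)))))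

    code : Carrierᴹ → ℕ
    code v = proj₁ (encode v)

    vec-code : ∀ v → vec (code v) ≈ᴹ v
    vec-code v = proj₂ (encode v)

    LegalMove : List ℕ → ℕ → Set
    LegalMove []      v = ¬ vec v ≈ᴹ 0ᴹ
    LegalMove (u ∷ _) v = ¬ vec v ≈ᴹ 0ᴹ × vec u ≪ vec v

    data Generated (S : Pred ℕ 0ℓ) : Pred Carrierᴹ 0ℓ where
      zero : ∀ {v} → v ≈ᴹ 0ᴹ → Generated S v
      add  : ∀ {v u s} a → s ∈ S → Generated S u → v ≈ᴹ a *ₗ vec s +ᴹ u → Generated S v

    Generated-mono : ∀ {S T} → S ⊆ T → Generated S ⊆ Generated T
    Generated-mono S⊆T (zero v≈)        = zero v≈
    Generated-mono S⊆T (add a s∈ u∈ v≈) = add a (S⊆T s∈) (Generated-mono S⊆T u∈) v≈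

    Generated-⊆ : ∀ (Z : BlockSeq) {v} → Generated (λ s → vec s ∈ ⟨ proj₁ Z ⟩) v → v ∈ ⟨ proj₁ Z ⟩
    Generated-⊆ Z (zero v≈)        = span-resp (proj₁ Z) (≈ᴹ-sym v≈) (span-0 (proj₁ Z))
    Generated-⊆ Z (add a s∈ u∈ v≈) =
      span-resp (proj₁ Z) (≈ᴹ-sym v≈) (span-+ (proj₁ Z) (span-* (proj₁ Z) a s∈) (Generated-⊆ Z u∈))

    Generated-lin : ∀ {S n} (x : ℕ → ℕ) (c : Vector Scalar n) → (∀ i → i < n → x i ∈ S) →
                    Generated S (lin (vec ∘ x) c)
    Generated-lin {n = zero}  x c x∈ = zero ≈ᴹ-refl
    Generated-lin {n = suc n} x c x∈ = add (c Fin.zero) (x∈ 0 (s≤s z≤n))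
      (Generated-lin (x ∘ suc) (c ∘ Fin.suc) (λ i lt → x∈ (suc i) (s≤s lt))) ≈ᴹ-refl

    Generated-resp : ∀ {S u v} → u ≈ᴹ v → Generated S u → Generated S v
    Generated-resp u≈v (zero u≈)         = zero (≈ᴹ-trans (≈ᴹ-sym u≈v) u≈)
    Generated-resp u≈v (add a s∈ u∈ u≈) = add a s∈ u∈ (≈ᴹ-trans (≈ᴹ-sym u≈v) u≈)

    -- The support of the last vector lies below its `size`, and the block with that number starts
    -- at or above it.
    legalMove-exists : ∀ w (Z : BlockSeq) → ∃[ v ] vec v ∈ ⟨ proj₁ Z ⟩ × LegalMove w v
    legalMove-exists w Z@(z , nonzero , _) = 
      code (z m) , span-resp z (≈ᴹ-sym (vec-code (z m))) (span-generator z m) , legal w refl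
      where
      last : List ℕ → ℕ
      last []      = 0
      last (u ∷ _) = size (vec u)

      m = last w

      legal : ∀ w → last w ≡ m → LegalMove w (code (z m))
      legal [] _     = λ v≈0 → nonzero m (≈ᴹ-trans (≈ᴹ-sym (vec-code (z m))) v≈0)
      legal (u ∷ _) eq = (λ v≈0 → nonzero m (≈ᴹ-trans (≈ᴹ-sym (vec-code (z m))) v≈0)) ,
        λ i∈ j∈ → ≤-trans (supp-< i∈) (≤-trans (≤-reflexive eq) (block-≥ Z m (supp-resp (vec-code (z m)) j∈)))

    𝕊 : Space
    𝕊 = record
      { Sub          = BlockSeq
      ; _∋_          = λ Z v → vec v ∈ ⟨ proj₁ Z ⟩
      ; Above        = λ N v → N <supp vec v
      ; Above-mono   = λ m≤n above j∈ → ≤-trans (s≤s m≤n) (above j∈)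
      ; Legal        = LegalMove
      ; legal-exists = legalMove-exists
      ; Span         = λ S v → Generated S (vec v)
      ; Span-mono    = λ S⊆T → Generated-mono S⊆T
      ; Span-closed  = λ Z → Generated-⊆ Z
      ; tail         = tailSeq
      ; tail-∋       = λ {Z} {N} → tailSeq-⊆ Z N
      ; tail-Above   = λ {Z} {N} → tailSeq-above Z N
      }

    open Space 𝕊 using (_∋_; Meets) renaming (_≼_ to _≼ᶜ_; _≼*_ to _≼*ᶜ_)

    ≼⇒≼ᶜ : ∀ {Z Y} → Z ≼ Y → Z ≼ᶜ Y
    ≼⇒≼ᶜ Z≼Y ∋v = Z≼Y ∋v

    ≼ᶜ⇒≼ : ∀ Z Y → Z ≼ᶜ Y → Z ≼ Y
    ≼ᶜ⇒≼ Z Y Z≼Y {v} v∈ = span-resp (proj₁ Y) (vec-code v) (Z≼Y (span-resp (proj₁ Z) (≈ᴹ-sym (vec-code v)) v∈))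

    ≼*⇒≼*ᶜ : ∀ {Y X} → Y ≼* X → Y ≼*ᶜ X
    ≼*⇒≼*ᶜ {Y} {X} (m , tail⊆) = bound (proj₁ Y) m , λ ∋v above → tail⊆ (drop-initial Y m ∋v above)

    infixr 5 _▹_

    _▹_ : List ℕ → (ℕ → ℕ) → ℕ → ℕ
    ([]      ▹ m) n       = m n
    ((c ∷ _) ▹ m) zero    = c
    ((_ ∷ w) ▹ m) (suc n) = (w ▹ m) n

    ▹-after : ∀ w m k → (w ▹ m) (length w + k) ≡ m k
    ▹-after []      m k = refl
    ▹-after (c ∷ w) m k = ▹-after w m k

    ▹-before : ∀ w m m′ {k} → k < length w → (w ▹ m) k ≡ (w ▹ m′) k
    ▹-before (c ∷ w) m m′ {zero}  _        = refl
    ▹-before (c ∷ w) m m′ {suc k} (s≤s lt) = ▹-before w m m′ lt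

    vec-▹ : ∀ xs y m → (∀ k → vec (m k) ≈ᴹ y k) → ∀ n → vec ((map code xs ▹ m) n) ≈ᴹ (xs ⌢ y) n
    vec-▹ []       y m eq n       = eq n
    vec-▹ (x ∷ xs) y m eq zero    = vec-code x
    vec-▹ (x ∷ xs) y m eq (suc n) = vec-▹ xs y m eq n

    block-resp : ∀ {x y : ℕ → Carrierᴹ} → (∀ n → x n ≈ᴹ y n) → IsBlock x → IsBlock y
    block-resp x≈y (nonzero , succ) =
      (λ n y≈0 → nonzero n (≈ᴹ-trans (x≈y n) y≈0)) , λ n → ≪-resp (x≈y n) (x≈y (suc n)) (succ n)

    legal⇒block : ∀ (z : ℕ → ℕ) → (∀ k → LegalMove (applyDownFrom z k) (z k)) → IsBlock (vec ∘ z)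
    legal⇒block z legal = nonzero , λ n → proj₂ (legal (suc n))
      where
      nonzero : ∀ n → ¬ vec (z n) ≈ᴹ 0ᴹ
      nonzero zero    = legal 0
      nonzero (suc n) = proj₁ (legal (suc n))

    block⇒legal : ∀ (z : ℕ → ℕ) → IsBlock (vec ∘ z) → ∀ k → LegalMove (applyDownFrom z k) (z k)
    block⇒legal z (nonzero , succ) zero    = nonzero 0
    block⇒legal z (nonzero , succ) (suc k) = nonzero (suc k) , succ k

    module _ (x : FinBlockSeq) where

      private
        xs = proj₁ x
        cs = map code xs

      initialPosition : List ℕ
      initialPosition = applyDownFrom (cs ▹ λ _ → 0) (length cs)

      length-initialPosition : length initialPosition ≡ length cs
      length-initialPosition = length-applyDownFrom _ (length cs)

      initialPosition-▹ : ∀ m → applyDownFrom (cs ▹ m) (length initialPosition) ≡ initialPosition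
      initialPosition-▹ m = trans (cong (applyDownFrom (cs ▹ m)) length-initialPosition)
        (applyDownFrom-cong (length cs) λ k → ▹-before cs m (λ _ → 0))

      initial-legal : ∀ z → applyDownFrom z (length initialPosition) ≡ initialPosition →
                      ∀ k → k < length initialPosition → LegalMove (applyDownFrom z k) (z k)
      initial-legal z start = legal
        where
        y : ℕ → Carrierᴹ
        y _ = vec 0

        inside : ∀ {k} → k < length initialPosition → k < length xs
        inside {k} = subst (k <_) (trans length-initialPosition (length-map code xs))

        agrees : ∀ k → k < length initialPosition → vec (z k) ≈ᴹ (xs ⌢ y) k
        agrees k lt = ≈ᴹ-trans
          (≈ᴹ-reflexive (cong vec (applyDownFrom-≡ {f = z} (trans start (sym (initialPosition-▹ λ _ → 0))) lt)))
          (vec-▹ xs y (λ _ → 0) (λ _ → ≈ᴹ-refl) k)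

        all : ∀ xs → All (λ v → ¬ v ≈ᴹ 0ᴹ) xs → ∀ k → k < length xs → ¬ (xs ⌢ y) k ≈ᴹ 0ᴹ
        all (x ∷ xs) (px All.∷ pxs) zero    _        = px
        all (x ∷ xs) (px All.∷ pxs) (suc k) (s≤s lt) = all xs pxs k lt

        linked : ∀ xs → Linked _≪_ xs → ∀ k → suc k < length xs → (xs ⌢ y) k ≪ (xs ⌢ y) (suc k)
        linked (_ ∷ [])     _               k       (s≤s ())
        linked (_ ∷ _ ∷ _)  (l Linked.∷ ls) zero    _        = l
        linked (_ ∷ x ∷ xs) (l Linked.∷ ls) (suc k) (s≤s lt) = linked (x ∷ xs) ls k lt

        nonzero : ∀ k → k < length initialPosition → ¬ vec (z k) ≈ᴹ 0ᴹ
        nonzero k lt v≈0 = all xs (proj₁ (proj₂ x)) k (inside lt) (≈ᴹ-trans (≈ᴹ-sym (agrees k lt)) v≈0)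

        legal : ∀ k → k < length initialPosition → LegalMove (applyDownFrom z k) (z k)
        legal zero    lt = nonzero 0 lt
        legal (suc k) lt = nonzero (suc k) lt ,
          ≪-resp (≈ᴹ-sym (agrees k (<-trans (n<1+n k) lt))) (≈ᴹ-sym (agrees (suc k) lt))
                 (linked xs (proj₂ (proj₂ x)) k (inside lt))

      legal-everywhere : ∀ z → applyDownFrom z (length initialPosition) ≡ initialPosition →
        (∀ k → length initialPosition ≤ k → LegalMove (applyDownFrom z k) (z k)) →
        ∀ k → LegalMove (applyDownFrom z k) (z k)
      legal-everywhere z start legal k with k <? length initialPosition
      ... | yes k< = initial-legal z start k k<
      ... | no k≮  = legal k (≮⇒≥ k≮)

      module Play (Y : BlockSeq) (St : Set) (s₀ : St) (position : St → List ℕ)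
        (next : ∀ s Z → Z ≼ᶜ Y →
                ∃[ v ] Z ∋ v × LegalMove (position s) v × (∃[ s′ ] position s′ ≡ v ∷ position s))
        (position-s₀ : position s₀ ≡ initialPosition) where

        private
          respond : St → BlockSeq → ℕ × St
          respond s Z with em {P = Z ≼ᶜ Y}
          ... | yes Z≼Y = let v , _ , _ , s′ , _ = next s Z Z≼Y in v , s′
          ... | no _    = 0 , s

          -- Excluded middle may return another proof of `Z ≼ᶜ Y` than the one at hand, and `next`
          -- may depend on it; the proof actually used is therefore recorded.
          Responds : St → BlockSeq → ℕ × St → Set
          Responds s Z (v , s′) = Σ[ Z≼Y ∈ Z ≼ᶜ Y ]
            v ≡ proj₁ (next s Z Z≼Y) × s′ ≡ proj₁ (proj₂ (proj₂ (proj₂ (next s Z Z≼Y))))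

          respond-next : ∀ s Z → Z ≼ᶜ Y → Responds s Z (respond s Z)
          respond-next s Z Z≼Y with em {P = Z ≼ᶜ Y}
          ... | yes Z≼Y′ = Z≼Y′ , refl , refl
          ... | no Z⋠Y   = ⊥-elim (Z⋠Y Z≼Y)

          respond-legal : ∀ s Z → Z ≼ᶜ Y → let v , s′ = respond s Z in
                          Z ∋ v × LegalMove (position s) v × position s′ ≡ v ∷ position s
          respond-legal s Z Z≼Y with respond s Z | respond-next s Z Z≼Y
          ... | _ | Z≼Y′ , refl , refl = let _ , ∋v , legal , _ , eq = next s Z Z≼Y′ in ∋v , legal , eq

          last : St → List BlockSeq → ℕ
          last s []            = 0
          last s (Z ∷ [])      = proj₁ (respond s Z)
          last s (Z ∷ W ∷ Zs) = last (proj₂ (respond s Z)) (W ∷ Zs)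

          stateFrom : St → (ℕ → BlockSeq) → ℕ → St
          stateFrom s V zero    = s
          stateFrom s V (suc k) = stateFrom (proj₂ (respond s (V 0))) (V ∘ suc) k

          stateFrom-suc : ∀ s V k → stateFrom s V (suc k) ≡ proj₂ (respond (stateFrom s V k) (V k))
          stateFrom-suc s V zero    = refl
          stateFrom-suc s V (suc k) = stateFrom-suc _ (V ∘ suc) k

          last-applyUpTo : ∀ s V k → last s (applyUpTo V (suc k)) ≡ proj₁ (respond (stateFrom s V k) (V k))
          last-applyUpTo s V zero    = refl
          last-applyUpTo s V (suc k) = last-applyUpTo _ (V ∘ suc) k

        module _ (V : ℕ → BlockSeq) (V≼Y : ∀ k → V k ≼ Y) where

          moves : ℕ → ℕ
          moves k = last s₀ (applyUpTo V (suc k))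

          states : ℕ → St
          states = stateFrom s₀ V

          play : ℕ → ℕ
          play = cs ▹ moves

          states-next : ∀ k → ∃[ Z ] Σ[ Z≼Y ∈ Z ≼ᶜ Y ]
                        states (suc k) ≡ proj₁ (proj₂ (proj₂ (proj₂ (next (states k) Z Z≼Y))))
          states-next k = let Z≼Y , _ , eq = respond-next (states k) (V k) (V≼Y k)
                          in V k , (λ {v} → Z≼Y {v}) , trans (stateFrom-suc s₀ V k) eq

          private
            stepped : ∀ k → V k ∋ moves k × LegalMove (position (states k)) (moves k) ×
                            position (states (suc k)) ≡ moves k ∷ position (states k)
            stepped k =
              let ∋v , legal , eq = respond-legal (states k) (V k) (V≼Y k)
                  move≡ = sym (last-applyUpTo s₀ V k)
              in subst (V k ∋_) move≡ ∋v , subst (LegalMove (position (states k))) move≡ legal ,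
                 trans (cong position (stateFrom-suc s₀ V k)) (trans eq (cong (_∷ position (states k)) move≡))

          moves∈ : ∀ k → V k ∋ moves k
          moves∈ k = proj₁ (stepped k)

          play-start : applyDownFrom play (length initialPosition) ≡ initialPosition
          play-start = initialPosition-▹ moves

          play-moves : ∀ k → play (length initialPosition + k) ≡ moves k
          play-moves k = trans (cong (λ n → play (n + k)) length-initialPosition) (▹-after cs moves k)

          play-position : ∀ k → applyDownFrom play (length initialPosition + k) ≡ position (states k)
          play-position zero    =
            trans (cong (applyDownFrom play) (+-identityʳ _)) (trans play-start (sym position-s₀))
          play-position (suc k) = trans (cong (applyDownFrom play) (+-suc _ k))
            (trans (cong₂ _∷_ (play-moves k) (play-position k)) (sym (proj₂ (proj₂ (stepped k)))))

          play-legal : ∀ k → length initialPosition ≤ k → LegalMove (applyDownFrom play k) (play k)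
          play-legal k le = subst (λ k → LegalMove (applyDownFrom play k) (play k)) (m+[n∸m]≡n le)
            (subst₂ LegalMove (sym (play-position i)) (sym (play-moves i)) (proj₁ (proj₂ (stepped i))))
            where i = k ∸ length initialPosition

        strategy : StrategyII x Y
        strategy = record
          { move  = λ Zs → vec (last s₀ Zs)
          ; legal = λ V V≼Y → moves∈ V V≼Y ,
              block-resp (vec-▹ xs _ (moves V V≼Y) (λ _ → ≈ᴹ-refl))
                (legal⇒block (play V V≼Y) (legal-everywhere (play V V≼Y) (play-start V V≼Y) (play-legal V V≼Y)))
          }

    strategicFilter : StrategicFilter 𝕊 U
    strategicFilter = record
      { inhabited = IsFamily.nonempty family
      -- `Z` is `≼*` its own tail, the witness being the number of blocks dropped.
      ; tail∈     = λ {Z} {N} Z∈U → IsFamily.upward family Z∈U (suc N , id)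
      ; meet      = λ X∈U Y∈U → let Z , Z∈U , Z≼X , Z≼Y = proj₂ (proj₁ pfilter) X∈U Y∈U
                                in Z , Z∈U , (λ ∋v → Z≼X ∋v) , λ ∋v → Z≼Y ∋v
      ; full      = full
      ; pseudo    = λ X X∈U decreasing →
          let Y , Y∈U , Y≼* = proj₂ (proj₂ pfilter) X X∈U λ n → ≼ᶜ⇒≼ (X (suc n)) (X n) (decreasing n)
          in Y , Y∈U , λ n → ≼*⇒≼*ᶜ {Y} {X n} (Y≼* n)
      ; strategic = strategic
      }
      where
      family = proj₁ (proj₁ pfilter)

      full : ∀ (D : Pred ℕ 0ℓ) X → X ∈ U →
             (∀ Y → Y ∈ U → Y ≼ᶜ X → ∃[ Z ] Z ≼ᶜ Y × (∀ {v} → Z ∋ v → v ∈ D)) →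
             ∃[ Z ] Z ∈ U × (∀ {v} → Z ∋ v → v ∈ D)
      full D X X∈U dense =
        let Z , (Z∈U , _) , Z⊆ = proj₁ (proj₂ pfilter) Dᴹ
              (λ u≈v u∈ n eq → u∈ n (≈ᴹ-trans eq (≈ᴹ-sym u≈v))) X X∈U
              λ Y (Y∈U , Y≼X) → let Z , Z≼Y , Z⊆D = dense Y Y∈U (≼⇒≼ᶜ {Y} {X} Y≼X) in
                Z , ≼ᶜ⇒≼ Z Y Z≼Y , λ v∈ n eq → Z⊆D (span-resp (proj₁ Z) (≈ᴹ-sym eq) v∈)
        in Z , Z∈U , λ {v} ∋v → Z⊆ ∋v v ≈ᴹ-refl
        where
        -- All codes of `u` are required to lie in `D`, so that the set respects `≈ᴹ`.
        Dᴹ : Pred Carrierᴹ 0ℓ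
        Dᴹ u = ∀ n → vec n ≈ᴹ u → n ∈ D

      strategic : ∀ X → X ∈ U → (G : Pred (List ℕ) 0ℓ) → [] ∈ G →
        (∀ w → w ∈ G → Meets X (λ v → LegalMove w v × (v ∷ w) ∈ G)) →
        ∃[ Z ] ∃[ z ] Z ∈ U × Space.Generates 𝕊 z Z × (∀ k → applyDownFrom z k ∈ G)
      strategic X X∈U G []∈G meets =
        let V , V≼X , outcome∈U = strategicU X X∈U strategy
        in outcome strategy V V≼X , moves V V≼X , outcome∈U ,
           (λ (n , c , v≈) → n , Generated-resp (≈ᴹ-sym v≈)
             (Generated-lin (moves V V≼X) c λ i → ∈-applyDownFrom⁺ (moves V V≼X))) ,
           λ k → subst G (sym (play-position V V≼X k)) (proj₂ (states V V≼X k))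
        where
        continue : ∀ (s : Σ[ w ∈ List ℕ ] w ∈ G) Z → Z ≼ᶜ X →
                   ∃[ v ] Z ∋ v × LegalMove (proj₁ s) v ×
                   (Σ[ s′ ∈ (Σ[ w ∈ List ℕ ] w ∈ G) ] proj₁ s′ ≡ v ∷ proj₁ s)
        continue (w , w∈G) Z Z≼X = let v , ∋v , legal , vw∈G = meets w w∈G Z Z≼X
                                   in v , ∋v , legal , (v ∷ w , vw∈G) , refl

        open Play ∅ X (Σ[ w ∈ List ℕ ] w ∈ G) ([] , []∈G) proj₁ continue refl

    open Ramsey em 𝕊 U strategicFilter using (FOutcome; WinningII; module Parametrized)

    -- Translation back to block sequences

    module _ (A : Pred (Cantor × BlockSeq) 0ℓ) (analytic : IsAnalytic A)
      (x : FinBlockSeq) (X : BlockSeq) (X∈U : X ∈ U) (p : PerfectTree) where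

      private
        xs = proj₁ x
        cs = map code xs
        w₀ = initialPosition x
        C = proj₁ analytic

        Codes : Cantor → (ℕ → ℕ) → (ℕ → ℕ) → Set
        Codes f z g = Σ[ Z ∈ BlockSeq ] ((f , Z , g) ∈ C × (∀ i → proj₁ Z i ≈ᴹ vec (z i)))

        -- Closedness compares sequences up to `≈ᴹ`, so `Z` itself approximates `Z′` to every
        -- length.
        C-resp : ∀ {f g} (Z Z′ : BlockSeq) → (∀ i → proj₁ Z i ≈ᴹ proj₁ Z′ i) →
                 (f , Z , g) ∈ C → (f , Z′ , g) ∈ C
        C-resp {f} {g} Z Z′ Z≈Z′ ∈C = proj₁ (proj₂ analytic) f Z′ g λ n →
          f , Z , g , ∈C , λ k _ → refl , ≈ᴹ-sym (Z≈Z′ k) , refl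

        Codes-closed : ∀ f z g → (∀ k → length w₀ ≤ k → LegalMove (applyDownFrom z k) (z k)) →
          applyDownFrom z (length w₀) ≡ w₀ →
          (∀ n → ∃[ f′ ] ∃[ z′ ] ∃[ g′ ] Codes f′ z′ g′ ×
                 (∀ k → k < n → f k ≡ f′ k × z k ≡ z′ k × g k ≡ g′ k)) →
          Codes f z g
        Codes-closed f z g legal start approx = Z , proj₁ (proj₂ analytic) f Z g near , λ _ → ≈ᴹ-refl
          where
          Z : BlockSeq
          Z = vec ∘ z , legal⇒block z (legal-everywhere x z start legal)

          near : ∀ n → ∃[ f′ ] ∃[ Z′ ] ∃[ g′ ] (f′ , Z′ , g′) ∈ C ×
                 (∀ k → k < n → f k ≡ f′ k × proj₁ Z k ≈ᴹ proj₁ Z′ k × g k ≡ g′ k)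
          near n = let f′ , z′ , g′ , (Z′ , ∈C , Z′≈) , same = approx n in
            f′ , Z′ , g′ , ∈C , λ k k<n → let f≡ , z≡ , g≡ = same k k<n in
              f≡ , ≈ᴹ-trans (≈ᴹ-reflexive (cong vec z≡)) (≈ᴹ-sym (Z′≈ k)) , g≡

        -- In `F[x⃗,Y]` a strategy for I sees only the moves of II, earliest first; positions also
        -- contain `x⃗` and list the latest vector first.
        positionAfter : List Carrierᴹ → List ℕ
        positionAfter = foldl (λ w v → code v ∷ w) w₀

        positionAfter-applyUpTo : ∀ y k →
          positionAfter (applyUpTo y k) ≡ applyDownFrom (cs ▹ (code ∘ y)) (length w₀ + k)
        positionAfter-applyUpTo y zero    = sym
          (trans (cong (applyDownFrom _) (+-identityʳ _)) (initialPosition-▹ x (code ∘ y)))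
        positionAfter-applyUpTo y (suc k) = begin
          positionAfter (applyUpTo y (suc k))            ≡⟨ cong positionAfter (applyUpTo-∷ʳ y k) ⟨
          positionAfter (applyUpTo y k ∷ʳ y k)           ≡⟨ foldl-∷ʳ _ w₀ (y k) (applyUpTo y k) ⟩
          code (y k) ∷ positionAfter (applyUpTo y k)
            ≡⟨ cong₂ _∷_ (sym (trans (cong (λ n → z (n + k)) (length-initialPosition x))
                                     (▹-after cs (code ∘ y) k)))
                         (positionAfter-applyUpTo y k) ⟩
          applyDownFrom z (suc (length w₀ + k))          ≡⟨ cong (applyDownFrom z) (+-suc _ k) ⟨
          applyDownFrom z (length w₀ + suc k)            ∎
          where
          open ≡-Reasoning
          z = cs ▹ (code ∘ y)

        outcomeF-codes : ∀ Y σ Z → Z ∈ OutcomeF x Y (σ ∘ positionAfter) →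
                         ∃[ z ] FOutcome w₀ Y σ z × (∀ i → proj₁ Z i ≈ᴹ vec (z i))
        outcomeF-codes Y σ (Z , block) (y , moves , Z≈) = z , (initialPosition-▹ x (code ∘ y) , play) , Z≈z
          where
          z = cs ▹ (code ∘ y)

          Z≈z : ∀ i → Z i ≈ᴹ vec (z i)
          Z≈z i = ≈ᴹ-trans (Z≈ i) (≈ᴹ-sym (vec-▹ xs y (code ∘ y) (vec-code ∘ y) i))

          z-after : ∀ k → z (length w₀ + k) ≡ code (y k)
          z-after k = trans (cong (λ n → z (n + k)) (length-initialPosition x)) (▹-after cs (code ∘ y) k)

          Move : ℕ → Set
          Move k = Y ∋ z k × LegalMove (applyDownFrom z k) (z k) × σ (applyDownFrom z k) <supp vec (z k)

          move : ∀ k → Move (length w₀ + k)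
          move k =
            subst (Y ∋_) (sym (z-after k)) (span-resp (proj₁ Y) (≈ᴹ-sym (vec-code (y k))) (proj₁ (moves k))) ,
            block⇒legal z (block-resp Z≈z block) (length w₀ + k) ,
            subst₂ (λ n v → n <supp vec v) (cong σ (positionAfter-applyUpTo y k)) (sym (z-after k))
              λ j∈ → proj₂ (moves k) (supp-resp (vec-code (y k)) j∈)

          play : ∀ k → length w₀ ≤ k → Move k
          play k le = subst Move (m+[n∸m]≡n le) (move (k ∸ length w₀))

        winning⇒strategy : ∀ f Y → WinningII w₀ Y (λ z → ∃[ g ] Codes f z g) →
          Σ[ α ∈ StrategyII x Y ] ∀ V V≼Y → (f , outcome α V V≼Y) ∈ A
        winning⇒strategy f Y W = strategy , λ V V≼Y →
          let g , Z , ∈C , Z≈ = wins (states V V≼Y) (play V V≼Y) refl (states-next V V≼Y)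
                                     (play-position V V≼Y) (play-legal V V≼Y)
          in Equivalence.from (proj₂ (proj₂ analytic) f (outcome strategy V V≼Y)) (g ,
               C-resp Z (outcome strategy V V≼Y)
                 (λ i → ≈ᴹ-trans (Z≈ i) (vec-▹ xs _ (moves V V≼Y) (λ _ → ≈ᴹ-refl) i)) ∈C)
          where
          open WinningII W
          open Play x Y State initial position next position-initial

      perfectlyRamsey : ∃[ Y ] Σ[ q ∈ PerfectTree ] Y ∈ (U ↾ X) × q ≤ᵀ p ×
        ( (Σ[ σ ∈ StrategyI ] ∀ f Z → f ∈ [ q ]ᵀ → Z ∈ OutcomeF x Y σ → (f , Z) ∉ A)
        ⊎ (∀ f → f ∈ [ q ]ᵀ → Σ[ α ∈ StrategyII x Y ] ∀ V V≼Y → (f , outcome α V V≼Y) ∈ A) )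
      perfectlyRamsey with Parametrized.parametrizedRamsey Codes w₀ Codes-closed X X∈U p
      ... | Y , Y∈U , Y≼X , q , q≤p , inj₁ (σ , avoids) =
        Y , q , (Y∈U , ≼ᶜ⇒≼ Y X Y≼X) , q≤p , inj₁ (σ ∘ positionAfter , λ f Z f∈ Z∈ ∈A →
          let z , out , Z≈ = outcomeF-codes Y σ Z Z∈
              g , ∈C = Equivalence.to (proj₂ (proj₂ analytic) f Z) ∈A
          in avoids f f∈ z out (g , Z , ∈C , Z≈))
      ... | Y , Y∈U , Y≼X , q , q≤p , inj₂ winning =
        Y , q , (Y∈U , ≼ᶜ⇒≼ Y X Y≼X) , q≤p , inj₂ λ f f∈ → winning⇒strategy f Y (winning f f∈)

theorem7p6 : (∀ {ℓ} → ExcludedMiddle ℓ) →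
    (F : CommutativeRing 0ℓ 0ℓ) → IsField F → IsCountable F →
    (E : Module F 0ℓ 0ℓ) (e : ℕ → Module.Carrierᴹ E) → IsBasis E e →
    let open Blocks E e in
    (U : Pred BlockSeq 0ℓ) → IsP⁺Filter U → IsStrategic U →
    (A : Pred (Cantor × BlockSeq) 0ℓ) → IsAnalytic A →
    PerfectlyStrategicallyRamsey U A
theorem7p6 em F _ countable E e basis U pfilter strategicU A analytic x X X∈U p =
  perfectlyRamsey A analytic x X X∈U p
  where
  open Coordinates em E e basis
  open Coded U pfilter strategicU countable
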